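{- Let $d\ge2$, let $f$ be a polynomial in $X_1,\dots,X_{d-1}$ with integer coefficients and constant term $0$ (with a fixed order of multiplication of variables in each monomial), and let $c\in\mathbb{Z}$. For a finite ring $R$ let $V_{f,c}(R)=\{(x_1,\dots,x_d)\in R^d : x_d=f(x_1,\dots,x_{d-1})+c\}$ and let $C_R$ denote the $V_{f,c}$-Salem number of $R$. Suppose $R=R_1\times R_2$ is a nontrivial product decomposition of a finite ring $R$ (with $R_1,R_2$ nonzero rings). Then $$C_R=\max\left(C_{R_1}|V_{f,c}(R_2)|^{\frac12},\ C_{R_2}|V_{f,c}(R_1)|^{\frac12}\right).$$
   Context: Rings are unital with $1\neq 0$ and not necessarily commutative; a polynomial with integer coefficients is a $\mathbb{Z}$-linear combination of words in the variables, so that it defines a function $R^{d-1}\to R$. For a finite ring $R$, a set $S\subseteq R^d$ and a character $\psi$ of the additive group of $R^d$, put $\widehat{S}(\psi)=\frac{1}{|R|^d}\sum_{x\in S}\psi(x)$. The set $S$ is called $C$-Salem if $|\widehat{S}(\psi)|\le C\,|R|^{ -d}\,|S|^{1/2}$ for all nontrivial additive characters $\psi$ of $R^d$. The $V_{f,c}$-Salem number (or constant) of $R$ is the smallest $C$ such that $V_{f,c}(R)$ is $C$-Salem. -}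

module Defs where

open import Algebra.Bundles using (AbelianGroup; Ring)
import Algebra.Construct.DirectProduct as DirectProduct
import Algebra.Construct.Pointwise as Pointwise
open import Algebra.Morphism.Structures using (module RingMorphisms)
import Algebra.Properties.Monoid.Mult as Mult
open import Data.Fin.Base as Fin using (Fin; finToFun; fromℕ; inject₁)
import Data.Fin.Properties as Finₚ
open import Data.Integer.Base as ℤ using (ℤ; +_; -[1+_])
import Data.Integer.Properties as ℤₚ
open import Data.List.Base as List using (List; []; _∷_)
open import Data.Nat.Base as ℕ using (ℕ; zero; suc)
import Data.Nat.DivMod as ℕ
import Data.Nat.Properties as ℕₚ
open import Data.Product.Base using (Σ-syntax; ∃-syntax; _×_; _,_)
open import Data.Rational.Base
open import Data.Rational.Properties
open import Data.Rational.Solver using (module +-*-Solver)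
open import Data.Rational.Unnormalised.Base as ℚᵘ using (mkℚᵘ; *≤*; *<*; *≡*)
import Data.Rational.Unnormalised.Properties as ℚᵘₚ
open import Data.Sum.Base using (inj₁; inj₂)
open import Function.Base using (_∘_)
open import Function.Bundles using (Inverse)
open import Function.Properties.Inverse using (Inverse⇒Injection)
open import Level using (Level) renaming (suc to lsuc; _⊔_ to _⊔ˡ_)
open import Relation.Binary.Definitions using () renaming (Decidable to Decidable₂)
open import Relation.Binary.PropositionalEquality
  using (_≡_; refl; sym; trans; cong; cong₂; subst; subst₂)
import Relation.Binary.PropositionalEquality as ≡
open import Relation.Nullary.Decidable using (yes; no; via-injection)
open import Relation.Nullary.Negation.Core using (¬_)
open import Relation.Unary using (Pred; Decidable)

infix  4 _≃ℝ_ _≤ℝ_ _≃ℂ_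
infixl 6 _+ℝ_ _-ℝ_ _⊔ℝ_ _+ℂ_
infixl 7 _*ℝ_ _*ℂ_ _·ℂ_

------------------------------------------------------------------------
-- Real numbers, as Cauchy sequences of rationals

IsCauchy : (ℕ → ℚ) → Set
IsCauchy x = ∀ ε → 0ℚ < ε →
  ∃[ N ] (∀ m n → N ℕ.≤ m → N ℕ.≤ n → ∣ x m - x n ∣ < ε)

record ℝ : Set where
  constructor mkℝ
  field
    seq    : ℕ → ℚ
    cauchy : IsCauchy seq

open ℝ public

_≃ℝ_ : ℝ → ℝ → Set
x ≃ℝ y = ∀ ε → 0ℚ < ε → ∃[ N ] (∀ n → N ℕ.≤ n → ∣ seq x n - seq y n ∣ < ε)

_≤ℝ_ : ℝ → ℝ → Set
x ≤ℝ y = ∀ ε → 0ℚ < ε → ∃[ N ] (∀ n → N ℕ.≤ n → seq x n < seq y n + ε)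

≤₁ : ∀ i j {k} → i ℕ.⊔ j ℕ.≤ k → i ℕ.≤ k
≤₁ i j = ℕₚ.m⊔n≤o⇒m≤o i j

≤₂ : ∀ i j {k} → i ℕ.⊔ j ℕ.≤ k → j ℕ.≤ k
≤₂ i j = ℕₚ.m⊔n≤o⇒n≤o i j

∣p∣≤q : ∀ {p q} → p ≤ q → - p ≤ q → ∣ p ∣ ≤ q
∣p∣≤q {p} p≤q -p≤q with ∣p∣≡p∨∣p∣≡-p p
... | inj₁ eq = subst (_≤ _) (sym eq) p≤q
... | inj₂ eq = subst (_≤ _) (sym eq) -p≤q

p≤∣p∣ : ∀ p → p ≤ ∣ p ∣
p≤∣p∣ p with ≤-total 0ℚ p
... | inj₁ 0≤p = ≤-reflexive (sym (0≤p⇒∣p∣≡p 0≤p))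
... | inj₂ p≤0 = ≤-trans p≤0 (0≤∣p∣ p)

∣p-q∣≡∣q-p∣ : ∀ p q → ∣ p - q ∣ ≡ ∣ q - p ∣
∣p-q∣≡∣q-p∣ p q = trans (sym (∣-p∣≡∣p∣ (p - q)))
  (cong ∣_∣ (solve 2 (λ a b → :- (a :- b) := b :- a) refl p q))
  where open +-*-Solver

p≤q+∣p-q∣ : ∀ p q → p ≤ q + ∣ p - q ∣
p≤q+∣p-q∣ p q = begin
  p                ≡⟨ solve 2 (λ a b → a := b :+ (a :- b)) refl p q ⟩
  q + (p - q)      ≤⟨ +-monoʳ-≤ q (p≤∣p∣ (p - q)) ⟩
  q + ∣ p - q ∣    ∎
  where open ≤-Reasoning
        open +-*-Solver

p≤q+r⇒p-q≤r : ∀ {p q r} → p ≤ q + r → p - q ≤ r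
p≤q+r⇒p-q≤r {p} {q} {r} p≤q+r = begin
  p - q        ≤⟨ +-monoˡ-≤ (- q) p≤q+r ⟩
  q + r - q    ≡⟨ solve 2 (λ b c → b :+ c :- b := c) refl q r ⟩
  r            ∎
  where open ≤-Reasoning
        open +-*-Solver

∣p-q∣≤r : ∀ {p q r} → p ≤ q + r → q ≤ p + r → ∣ p - q ∣ ≤ r
∣p-q∣≤r {p} {q} {r} p≤q+r q≤p+r = ∣p∣≤q (p≤q+r⇒p-q≤r p≤q+r)
  (subst (_≤ r) (solve 2 (λ a b → b :- a := :- (a :- b)) refl p q)
                (p≤q+r⇒p-q≤r q≤p+r))
  where open +-*-Solver

½*p+½*p≡p : ∀ p → ½ * p + ½ * p ≡ p
½*p+½*p≡p p = trans (sym (*-distribʳ-+ p ½ ½)) (*-identityˡ p)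

*-pos : ∀ {p q} → 0ℚ < p → 0ℚ < q → 0ℚ < p * q
*-pos {p} {q} 0<p 0<q = subst (_< p * q) (*-zeroʳ p)
  (*-monoʳ-<-pos p {{positive 0<p}} 0<q)

0<½*p : ∀ {p} → 0ℚ < p → 0ℚ < ½ * p
0<½*p = *-pos (positive⁻¹ ½)

-- Pointwise application of a binary operation that is 1-Lipschitz for the
-- sum metric.
lift₂-cauchy : ∀ (f : ℚ → ℚ → ℚ) →
  (∀ p q r s → ∣ f p q - f r s ∣ ≤ ∣ p - r ∣ + ∣ q - s ∣) →
  ∀ x y → IsCauchy (λ n → f (seq x n) (seq y n))
lift₂-cauchy f lip x y ε 0<ε with cauchy x (½ * ε) (0<½*p 0<ε)
                                | cauchy y (½ * ε) (0<½*p 0<ε)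
... | M , hx | N , hy = M ℕ.⊔ N , λ m n K≤m K≤n → begin-strict
  ∣ f (seq x m) (seq y m) - f (seq x n) (seq y n) ∣
    ≤⟨ lip _ _ _ _ ⟩
  ∣ seq x m - seq x n ∣ + ∣ seq y m - seq y n ∣
    <⟨ +-mono-< (hx m n (≤₁ M N K≤m) (≤₁ M N K≤n))
                (hy m n (≤₂ M N K≤m) (≤₂ M N K≤n)) ⟩
  ½ * ε + ½ * ε
    ≡⟨ ½*p+½*p≡p ε ⟩
  ε ∎
  where open ≤-Reasoning

lift₂ : ∀ (f : ℚ → ℚ → ℚ) →
  (∀ p q r s → ∣ f p q - f r s ∣ ≤ ∣ p - r ∣ + ∣ q - s ∣) → ℝ → ℝ → ℝ
lift₂ f lip x y = mkℝ (λ n → f (seq x n) (seq y n)) (lift₂-cauchy f lip x y)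

-- Stated separately because the solver is slow when applied to large terms.
module Identities where
  open +-*-Solver

  [p-r]+[q-s] : ∀ p q r s → (p - r) + (q - s) ≡ (p + q) - (r + s)
  [p-r]+[q-s] = solve 4 (λ p q r s → (p :- r) :+ (q :- s) := (p :+ q) :- (r :+ s)) refl

  [p-r]-[q-s] : ∀ p q r s → (p - r) - (q - s) ≡ (p - q) - (r - s)
  [p-r]-[q-s] = solve 4 (λ p q r s → (p :- r) :- (q :- s) := (p :- q) :- (r :- s)) refl

  p≡q+[p-q] : ∀ p q → p ≡ q + (p - q)
  p≡q+[p-q] = solve 2 (λ p q → p := q :+ (p :- q)) refl

  pq-rs : ∀ p q r s → p * q - r * s ≡ p * (q - s) + s * (p - r)
  pq-rs = solve 4 (λ p q r s → p :* q :- r :* s := p :* (q :- s) :+ s :* (p :- r)) refl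

  square-+ : ∀ p q → (p + q) * (p + q) ≡ (p * p + q * q) + (p * q + p * q)
  square-+ = solve 2 (λ p q → (p :+ q) :* (p :+ q) := (p :* p :+ q :* q) :+ (p :* q :+ p :* q)) refl

open Identities

+-lip : ∀ p q r s → ∣ (p + q) - (r + s) ∣ ≤ ∣ p - r ∣ + ∣ q - s ∣
+-lip p q r s = subst (λ t → ∣ t ∣ ≤ ∣ p - r ∣ + ∣ q - s ∣) ([p-r]+[q-s] p q r s)
  (∣p+q∣≤∣p∣+∣q∣ (p - r) (q - s))

-‿lip : ∀ p q r s → ∣ (p - q) - (r - s) ∣ ≤ ∣ p - r ∣ + ∣ q - s ∣
-‿lip p q r s = subst (λ t → ∣ t ∣ ≤ ∣ p - r ∣ + ∣ q - s ∣) ([p-r]-[q-s] p q r s)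
  (∣p-q∣≤∣p∣+∣q∣ (p - r) (q - s))

⊔-lip-≤ : ∀ p q r s → p ⊔ q ≤ (r ⊔ s) + (∣ p - r ∣ + ∣ q - s ∣)
⊔-lip-≤ p q r s = ⊔-lub
  (≤-trans (p≤q+∣p-q∣ p r) (+-mono-≤ (p≤p⊔q r s)
     (subst (_≤ a + b) (+-identityʳ a) (+-monoʳ-≤ a (0≤∣p∣ (q - s))))))
  (≤-trans (p≤q+∣p-q∣ q s) (+-mono-≤ (p≤q⊔p r s)
     (subst (_≤ a + b) (+-identityˡ b) (+-monoˡ-≤ b (0≤∣p∣ (p - r))))))
  where a = ∣ p - r ∣
        b = ∣ q - s ∣

⊔-lip : ∀ p q r s → ∣ (p ⊔ q) - (r ⊔ s) ∣ ≤ ∣ p - r ∣ + ∣ q - s ∣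
⊔-lip p q r s = ∣p-q∣≤r (⊔-lip-≤ p q r s)
  (subst (λ t → r ⊔ s ≤ (p ⊔ q) + t)
     (cong₂ _+_ (∣p-q∣≡∣q-p∣ r p) (∣p-q∣≡∣q-p∣ s q)) (⊔-lip-≤ r s p q))

bounded : ∀ (x : ℝ) → Σ[ B ∈ ℚ ] (0ℚ < B × ∃[ N ] (∀ n → N ℕ.≤ n → ∣ seq x n ∣ < B))
bounded x with cauchy x 1ℚ (positive⁻¹ 1ℚ)
... | N , h = B , ≤-<-trans (0≤∣p∣ (seq x N)) (a<a+1 ∣ seq x N ∣) , N , bound
  where
  B = ∣ seq x N ∣ + 1ℚ

  a<a+1 : ∀ a → a < a + 1ℚ
  a<a+1 a = subst (_< a + 1ℚ) (+-identityʳ a) (+-monoʳ-< a (positive⁻¹ 1ℚ))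

  bound : ∀ n → N ℕ.≤ n → ∣ seq x n ∣ < B
  bound n N≤n = begin-strict
    ∣ seq x n ∣
      ≡⟨ cong ∣_∣ (p≡q+[p-q] (seq x n) (seq x N)) ⟩
    ∣ seq x N + (seq x n - seq x N) ∣
      ≤⟨ ∣p+q∣≤∣p∣+∣q∣ (seq x N) (seq x n - seq x N) ⟩
    ∣ seq x N ∣ + ∣ seq x n - seq x N ∣
      <⟨ +-monoʳ-< ∣ seq x N ∣ (h n N N≤n ℕₚ.≤-refl) ⟩
    B ∎
    where open ≤-Reasoning

shrink : ∀ {B ε} → 0ℚ < B → 0ℚ < ε → Σ[ δ ∈ ℚ ] (0ℚ < δ × B * δ ≡ ε)
shrink {B} {ε} 0<B 0<ε = B⁻¹ * ε , *-pos 0<B⁻¹ 0<ε , eq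
  where
  instance
    B-pos = positive 0<B
    B-nonZero = pos⇒nonZero B
  B⁻¹ = 1/ B
  0<B⁻¹ : 0ℚ < B⁻¹
  0<B⁻¹ = positive⁻¹ B⁻¹ {{1/pos⇒pos B}}
  eq : B * (B⁻¹ * ε) ≡ ε
  eq = trans (sym (*-assoc B B⁻¹ ε))
         (trans (cong (_* ε) (*-inverseʳ B)) (*-identityˡ ε))

∣p∣*∣q∣<B*δ : ∀ {p q B δ} → 0ℚ < B → ∣ p ∣ < B → ∣ q ∣ < δ → ∣ p ∣ * ∣ q ∣ < B * δ
∣p∣*∣q∣<B*δ {p} {q} {B} {δ} 0<B p<B q<δ = ≤-<-trans
  (*-monoʳ-≤-nonNeg ∣ q ∣ {{∣-∣-nonNeg q}} (<⇒≤ p<B))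
  (*-monoʳ-<-pos B {{positive 0<B}} q<δ)

∣ab-cd∣< : ∀ {A B α β} a b c d → 0ℚ < A → 0ℚ < B →
  ∣ a ∣ < A → ∣ b - d ∣ < α → ∣ d ∣ < B → ∣ a - c ∣ < β →
  ∣ a * b - c * d ∣ < A * α + B * β
∣ab-cd∣< {A} {B} {α} {β} a b c d 0<A 0<B a<A b-d<α d<B a-c<β = begin-strict
  ∣ a * b - c * d ∣
    ≡⟨ cong ∣_∣ (pq-rs a b c d) ⟩
  ∣ a * (b - d) + d * (a - c) ∣
    ≤⟨ ∣p+q∣≤∣p∣+∣q∣ (a * (b - d)) (d * (a - c)) ⟩
  ∣ a * (b - d) ∣ + ∣ d * (a - c) ∣
    ≡⟨ cong₂ _+_ (∣p*q∣≡∣p∣*∣q∣ a (b - d)) (∣p*q∣≡∣p∣*∣q∣ d (a - c)) ⟩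
  ∣ a ∣ * ∣ b - d ∣ + ∣ d ∣ * ∣ a - c ∣
    <⟨ +-mono-< (∣p∣*∣q∣<B*δ {a} {b - d} 0<A a<A b-d<α)
                (∣p∣*∣q∣<B*δ {d} {a - c} 0<B d<B a-c<β) ⟩
  A * α + B * β ∎
  where open ≤-Reasoning

*-cauchy : ∀ x y → IsCauchy (λ n → seq x n * seq y n)
*-cauchy x y ε 0<ε =
  let A , 0<A , N₁ , hA = bounded x
      B , 0<B , N₂ , hB = bounded y
      α , 0<α , Aα≡½ε = shrink 0<A (0<½*p 0<ε)
      β , 0<β , Bβ≡½ε = shrink 0<B (0<½*p 0<ε)
      N₃ , hy = cauchy y α 0<α
      N₄ , hx = cauchy x β 0<β
  in (N₁ ℕ.⊔ N₂) ℕ.⊔ (N₃ ℕ.⊔ N₄) , λ m n K≤m K≤n →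
     subst (∣ seq x m * seq y m - seq x n * seq y n ∣ <_)
       (trans (cong₂ _+_ Aα≡½ε Bβ≡½ε) (½*p+½*p≡p ε))
       (∣ab-cd∣< (seq x m) (seq y m) (seq x n) (seq y n) 0<A 0<B
         (hA m (≤₁ N₁ N₂ (≤₁ (N₁ ℕ.⊔ N₂) (N₃ ℕ.⊔ N₄) K≤m)))
         (hy m n (≤₁ N₃ N₄ (≤₂ (N₁ ℕ.⊔ N₂) (N₃ ℕ.⊔ N₄) K≤m))
                 (≤₁ N₃ N₄ (≤₂ (N₁ ℕ.⊔ N₂) (N₃ ℕ.⊔ N₄) K≤n)))
         (hB n (≤₂ N₁ N₂ (≤₁ (N₁ ℕ.⊔ N₂) (N₃ ℕ.⊔ N₄) K≤n)))
         (hx m n (≤₂ N₃ N₄ (≤₂ (N₁ ℕ.⊔ N₂) (N₃ ℕ.⊔ N₄) K≤m))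
                 (≤₂ N₃ N₄ (≤₂ (N₁ ℕ.⊔ N₂) (N₃ ℕ.⊔ N₄) K≤n))))

isqrt : ℕ → ℕ
isqrt zero = zero
isqrt (suc m) with suc (isqrt m) ℕ.* suc (isqrt m) ℕₚ.≤? suc m
... | yes _ = suc (isqrt m)
... | no  _ = isqrt m

isqrt-lower : ∀ m → isqrt m ℕ.* isqrt m ℕ.≤ m
isqrt-lower zero = ℕ.z≤n
isqrt-lower (suc m) with suc (isqrt m) ℕ.* suc (isqrt m) ℕₚ.≤? suc m
... | yes p = p
... | no  _ = ℕₚ.m≤n⇒m≤1+n (isqrt-lower m)

r²-mono : ∀ r → suc r ℕ.* suc r ℕ.< suc (suc r) ℕ.* suc (suc r)
r²-mono r = ℕₚ.*-mono-< {suc r} {suc (suc r)} {suc r} {suc (suc r)} ℕₚ.≤-refl ℕₚ.≤-refl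

isqrt-upper : ∀ m → m ℕ.< suc (isqrt m) ℕ.* suc (isqrt m)
isqrt-upper zero = ℕ.s≤s ℕ.z≤n
isqrt-upper (suc m) with suc (isqrt m) ℕ.* suc (isqrt m) ℕₚ.≤? suc m
... | yes _ = ℕₚ.≤-<-trans (isqrt-upper m) (r²-mono (isqrt m))
... | no ¬p = ℕₚ.≰⇒> ¬p

1/suc : ℕ → ℚ
1/suc n = + 1 / suc n

sqrtNum : ℕ → ℚ → ℕ
sqrtNum n q = isqrt ((∣ ↥ q ∣ℤ ℕ.* (suc n ℕ.* suc n)) ℕ./ ↧ₙ q)
  where ∣_∣ℤ = ℤ.∣_∣

-- For q ≥ 0, the largest multiple of 1/(n+1) whose square is at most q.
sqrtℚ : ℕ → ℚ → ℚ
sqrtℚ n q = + sqrtNum n q / suc n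

toℚᵘ-/ : ∀ r n → toℚᵘ (+ r / suc n) ℚᵘ.≃ mkℚᵘ (+ r) n
toℚᵘ-/ r n = toℚᵘ-fromℚᵘ (mkℚᵘ (+ r) n)

/-nonNeg : ∀ r n → 0ℚ ≤ + r / suc n
/-nonNeg r n = toℚᵘ-cancel-≤ (ℚᵘₚ.≤-respʳ-≃ (ℚᵘₚ.≃-sym (toℚᵘ-/ r n))
  (*≤* (subst (+ 0 ℤ.≤_) (sym (ℤₚ.*-identityʳ (+ r))) (ℤ.+≤+ ℕ.z≤n))))

sqrtℚ-lower : ∀ n {q} → 0ℚ ≤ q → sqrtℚ n q * sqrtℚ n q ≤ q
sqrtℚ-lower n {q@(mkℚ (+ a) b-1 _)} _ = toℚᵘ-cancel-≤ (begin
  toℚᵘ (sqrtℚ n q * sqrtℚ n q)          ≃⟨ toℚᵘ-homo-* (sqrtℚ n q) (sqrtℚ n q) ⟩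
  toℚᵘ (sqrtℚ n q) ℚᵘ.* toℚᵘ (sqrtℚ n q) ≃⟨ ℚᵘₚ.*-cong (toℚᵘ-/ r n) (toℚᵘ-/ r n) ⟩
  mkℚᵘ (+ r) n ℚᵘ.* mkℚᵘ (+ r) n          ≤⟨ *≤* main ⟩
  toℚᵘ q                                 ∎)
  where
  open ℚᵘₚ.≤-Reasoning
  r = sqrtNum n q
  K² = suc n ℕ.* suc n
  r²b≤aK² : r ℕ.* r ℕ.* suc b-1 ℕ.≤ a ℕ.* K²
  r²b≤aK² = ℕₚ.≤-trans (ℕₚ.*-monoˡ-≤ (suc b-1) (isqrt-lower ((a ℕ.* K²) ℕ./ suc b-1)))
                       (ℕ.m/n*n≤m (a ℕ.* K²) (suc b-1))
  main : (+ r ℤ.* + r) ℤ.* + suc b-1 ℤ.≤ + a ℤ.* + K²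
  main = subst₂ ℤ._≤_
    (trans (ℤₚ.pos-* (r ℕ.* r) (suc b-1)) (cong (ℤ._* + suc b-1) (ℤₚ.pos-* r r)))
    (ℤₚ.pos-* a K²) (ℤ.+≤+ r²b≤aK²)
sqrtℚ-lower n {mkℚ -[1+ a ] b-1 _} (*≤* ())

1/suc-+ : ∀ r n → + r / suc n + 1/suc n ≡ + suc r / suc n
1/suc-+ r n = toℚᵘ-injective (begin-equality
  toℚᵘ (+ r / suc n + 1/suc n)           ≃⟨ toℚᵘ-homo-+ (+ r / suc n) (1/suc n) ⟩
  toℚᵘ (+ r / suc n) ℚᵘ.+ toℚᵘ (1/suc n)  ≃⟨ ℚᵘₚ.+-cong (toℚᵘ-/ r n) (toℚᵘ-/ 1 n) ⟩
  mkℚᵘ (+ r) n ℚᵘ.+ mkℚᵘ (+ 1) n           ≃⟨ *≡* main ⟩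
  mkℚᵘ (+ suc r) n                        ≃⟨ toℚᵘ-/ (suc r) n ⟨
  toℚᵘ (+ suc r / suc n)                  ∎)
  where
  open ℚᵘₚ.≤-Reasoning
  K = + suc n
  main : (+ r ℤ.* K ℤ.+ + 1 ℤ.* K) ℤ.* K ≡ + suc r ℤ.* (K ℤ.* K)
  main = trans (cong (ℤ._* K) (trans (sym (ℤₚ.*-distribʳ-+ K (+ r) (+ 1)))
                 (cong (ℤ._* K) (cong +_ (ℕₚ.+-comm r 1)))))
               (ℤₚ.*-assoc (+ suc r) K K)

sqrtℚ-upper : ∀ n {q} → 0ℚ ≤ q →
  q < (sqrtℚ n q + 1/suc n) * (sqrtℚ n q + 1/suc n)
sqrtℚ-upper n {q@(mkℚ (+ a) b-1 _)} _ =
  subst (λ t → q < t * t) (sym (1/suc-+ r n)) (toℚᵘ-cancel-< (begin-strict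
    toℚᵘ q                                        <⟨ *<* main ⟩
    mkℚᵘ (+ suc r) n ℚᵘ.* mkℚᵘ (+ suc r) n          ≃⟨ ℚᵘₚ.*-cong (toℚᵘ-/ (suc r) n) (toℚᵘ-/ (suc r) n) ⟨
    toℚᵘ (+ suc r / suc n) ℚᵘ.* toℚᵘ (+ suc r / suc n) ≃⟨ toℚᵘ-homo-* (+ suc r / suc n) (+ suc r / suc n) ⟨
    toℚᵘ ((+ suc r / suc n) * (+ suc r / suc n))  ∎))
  where
  open ℚᵘₚ.≤-Reasoning
  r = sqrtNum n q
  K² = suc n ℕ.* suc n
  aK²<[r+1]²b : a ℕ.* K² ℕ.< suc r ℕ.* suc r ℕ.* suc b-1
  aK²<[r+1]²b = ℕₚ.<-≤-trans
    (subst (ℕ._< suc ((a ℕ.* K²) ℕ./ suc b-1) ℕ.* suc b-1)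
       (sym (ℕ.m≡m%n+[m/n]*n (a ℕ.* K²) (suc b-1)))
       (ℕₚ.+-monoˡ-< (((a ℕ.* K²) ℕ./ suc b-1) ℕ.* suc b-1) (ℕ.m%n<n (a ℕ.* K²) (suc b-1))))
    (ℕₚ.*-monoˡ-≤ (suc b-1) (isqrt-upper ((a ℕ.* K²) ℕ./ suc b-1)))
  main : + a ℤ.* + K² ℤ.< (+ suc r ℤ.* + suc r) ℤ.* + suc b-1
  main = subst₂ ℤ._<_ (ℤₚ.pos-* a K²)
    (trans (ℤₚ.pos-* (suc r ℕ.* suc r) (suc b-1)) (cong (ℤ._* + suc b-1) (ℤₚ.pos-* (suc r) (suc r))))
    (ℤ.+<+ aK²<[r+1]²b)
sqrtℚ-upper n {mkℚ -[1+ a ] b-1 _} (*≤* ())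

archimedean : ∀ {ε} → 0ℚ < ε → ∃[ N ] (∀ n → N ℕ.≤ n → 1/suc n ≤ ε)
archimedean {mkℚ (+ zero) _ _} (*<* (ℤ.+<+ ()))
archimedean {mkℚ -[1+ _ ] _ _} (*<* ())
archimedean {ε@(mkℚ (+ suc a) b-1 _)} _ = suc b-1 , λ n b≤n → toℚᵘ-cancel-≤
  (ℚᵘₚ.≤-respˡ-≃ (ℚᵘₚ.≃-sym (toℚᵘ-/ 1 n)) (*≤* (subst₂ ℤ._≤_
     (sym (ℤₚ.*-identityˡ (+ suc b-1))) (ℤₚ.pos-* (suc a) (suc n))
     (ℤ.+≤+ (ℕₚ.≤-trans b≤n (ℕₚ.≤-trans (ℕₚ.n≤1+n n) (ℕₚ.m≤m+n (suc n) (a ℕ.* suc n))))))))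

*-mono-≤-nonNeg : ∀ {p q r s} → 0ℚ ≤ p → 0ℚ ≤ s → p ≤ q → r ≤ s → p * r ≤ q * s
*-mono-≤-nonNeg {p} {q} {r} {s} 0≤p 0≤s p≤q r≤s = ≤-trans
  (*-monoˡ-≤-nonNeg p {{nonNegative 0≤p}} r≤s) (*-monoʳ-≤-nonNeg s {{nonNegative 0≤s}} p≤q)

+-nonNeg : ∀ {p q} → 0ℚ ≤ p → 0ℚ ≤ q → 0ℚ ≤ p + q
+-nonNeg {p} {q} = +-mono-≤ {0ℚ} {p} {0ℚ} {q}

*-nonNeg : ∀ {p q} → 0ℚ ≤ p → 0ℚ ≤ q → 0ℚ ≤ p * q
*-nonNeg {p} {q} 0≤p 0≤q = subst (_≤ p * q) (*-zeroʳ p) (*-monoˡ-≤-nonNeg p {{nonNegative 0≤p}} 0≤q)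

p≤p+q : ∀ {p q} → 0ℚ ≤ q → p ≤ p + q
p≤p+q {p} {q} 0≤q = subst (_≤ p + q) (+-identityʳ p) (+-monoʳ-≤ p 0≤q)

-- If s² ≤ a, b < (t + δ)², a ≤ b + η² and δ ≤ η, then s < t + 2η.
sqrt-close : ∀ {a b s t δ η} → 0ℚ ≤ t → 0ℚ ≤ δ → 0ℚ ≤ η →
  s * s ≤ a → b < (t + δ) * (t + δ) → a ≤ b + η * η → δ ≤ η → s < t + (η + η)
sqrt-close {a} {b} {s} {t} {δ} {η} 0≤t 0≤δ 0≤η s²≤a b<[t+δ]² a≤b+η² δ≤η =
  ≰⇒> λ t+2η≤s → <-irrefl refl (begin-strict
    a                                       ≤⟨ a≤b+η² ⟩
    b + η * η                               <⟨ +-monoˡ-< (η * η) b<[t+δ]² ⟩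
    (t + δ) * (t + δ) + η * η               ≤⟨ p≤p+q (+-nonNeg 0≤uη 0≤uη) ⟩
    ((t + δ) * (t + δ) + η * η) + ((t + δ) * η + (t + δ) * η)
                                            ≡⟨ square-+ (t + δ) η ⟨
    ((t + δ) + η) * ((t + δ) + η)           ≤⟨ *-mono-≤-nonNeg 0≤u+η (≤-trans 0≤u+η (u+η≤s t+2η≤s)) (u+η≤s t+2η≤s) (u+η≤s t+2η≤s) ⟩
    s * s                                   ≤⟨ s²≤a ⟩
    a                                       ∎)
  where
  open ≤-Reasoning
  0≤uη : 0ℚ ≤ (t + δ) * η
  0≤uη = *-nonNeg (+-nonNeg 0≤t 0≤δ) 0≤η
  0≤u+η : 0ℚ ≤ (t + δ) + η
  0≤u+η = +-nonNeg (+-nonNeg 0≤t 0≤δ) 0≤η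
  u+η≤s : t + (η + η) ≤ s → (t + δ) + η ≤ s
  u+η≤s t+2η≤s = begin
    (t + δ) + η    ≤⟨ +-monoˡ-≤ η (+-monoʳ-≤ t δ≤η) ⟩
    (t + η) + η    ≡⟨ +-assoc t η η ⟩
    t + (η + η)    ≤⟨ t+2η≤s ⟩
    s              ∎

p<q+r⇒p-q<r : ∀ {p q r} → p < q + r → p - q < r
p<q+r⇒p-q<r {p} {q} {r} p<q+r = subst (p - q <_) (cancel q r) (+-monoˡ-< (- q) p<q+r)
  where
  open +-*-Solver
  cancel : ∀ q r → q + r - q ≡ r
  cancel = solve 2 (λ q r → q :+ r :- q := r) refl

∣p-q∣<r : ∀ {p q r} → p < q + r → q < p + r → ∣ p - q ∣ < r
∣p-q∣<r {p} {q} {r} p<q+r q<p+r with ∣p∣≡p∨∣p∣≡-p (p - q)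
... | inj₁ eq = subst (_< r) (sym eq) (p<q+r⇒p-q<r p<q+r)
... | inj₂ eq = subst (_< r) (trans (flip q p) (sym eq)) (p<q+r⇒p-q<r q<p+r)
  where
  open +-*-Solver
  flip : ∀ q p → q - p ≡ - (p - q)
  flip = solve 2 (λ q p → q :- p := :- (p :- q)) refl

0≤0⊔ : ∀ q → 0ℚ ≤ 0ℚ ⊔ q
0≤0⊔ q = p≤p⊔q 0ℚ q

0⊔-≤ : ∀ p q {r} → 0ℚ ≤ r → ∣ p - q ∣ < r → 0ℚ ⊔ p ≤ (0ℚ ⊔ q) + r
0⊔-≤ p q 0≤r p-q<r = ⊔-lub
  (+-nonNeg (0≤0⊔ q) 0≤r)
  (≤-trans (p≤q+∣p-q∣ p q) (+-mono-≤ (p≤q⊔p 0ℚ q) (<⇒≤ p-q<r)))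

√-cauchy : ∀ x → IsCauchy (λ n → sqrtℚ n (0ℚ ⊔ seq x n))
√-cauchy x ε 0<ε =
  let η = ½ * ε
      0<η = 0<½*p 0<ε
      N₁ , hx = cauchy x (η * η) (*-pos 0<η 0<η)
      N₂ , arch = archimedean 0<η
      close : ∀ m n → N₁ ℕ.⊔ N₂ ℕ.≤ m → N₁ ℕ.⊔ N₂ ℕ.≤ n →
              sqrtℚ m (0ℚ ⊔ seq x m) < sqrtℚ n (0ℚ ⊔ seq x n) + ε
      close m n K≤m K≤n = subst (λ t → sqrtℚ m (0ℚ ⊔ seq x m) < sqrtℚ n (0ℚ ⊔ seq x n) + t)
        (½*p+½*p≡p ε)
        (sqrt-close
          (/-nonNeg (sqrtNum n (0ℚ ⊔ seq x n)) n) (/-nonNeg 1 n) (<⇒≤ 0<η)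
          (sqrtℚ-lower m (0≤0⊔ (seq x m))) (sqrtℚ-upper n (0≤0⊔ (seq x n)))
          (0⊔-≤ (seq x m) (seq x n) (<⇒≤ (*-pos 0<η 0<η)) (hx m n (≤₁ N₁ N₂ K≤m) (≤₁ N₁ N₂ K≤n)))
          (arch n (≤₂ N₁ N₂ K≤n)))
  in N₁ ℕ.⊔ N₂ , λ m n K≤m K≤n → ∣p-q∣<r (close m n K≤m K≤n) (close n m K≤n K≤m)

_+ℝ_ _-ℝ_ _*ℝ_ _⊔ℝ_ : ℝ → ℝ → ℝ
_+ℝ_ = lift₂ _+_ +-lip
_-ℝ_ = lift₂ _-_ -‿lip
_⊔ℝ_ = lift₂ _⊔_ ⊔-lip
x *ℝ y = mkℝ (λ n → seq x n * seq y n) (*-cauchy x y)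

-- √ x is the square root of max(0, x).
√ : ℝ → ℝ
√ x = mkℝ (λ n → sqrtℚ n (0ℚ ⊔ seq x n)) (√-cauchy x)

fromℚ : ℚ → ℝ
fromℚ q = mkℝ (λ _ → q) λ ε 0<ε → 0 , λ _ _ _ _ → subst (λ t → ∣ t ∣ < ε) (sym (+-inverseʳ q)) 0<ε

fromℕʳ : ℕ → ℝ
fromℕʳ n = fromℚ (+ n / 1)

0ℝ 1ℝ : ℝ
0ℝ = fromℚ 0ℚ
1ℝ = fromℚ 1ℚ

------------------------------------------------------------------------
-- Complex numbers

record ℂ : Set where
  constructor _+i_
  field
    re im : ℝ

open ℂ public

_≃ℂ_ : ℂ → ℂ → Set
z ≃ℂ w = re z ≃ℝ re w × im z ≃ℝ im w

0ℂ 1ℂ : ℂ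
0ℂ = 0ℝ +i 0ℝ
1ℂ = 1ℝ +i 0ℝ

_+ℂ_ _*ℂ_ : ℂ → ℂ → ℂ
z +ℂ w = (re z +ℝ re w) +i (im z +ℝ im w)
z *ℂ w = (re z *ℝ re w -ℝ im z *ℝ im w) +i (re z *ℝ im w +ℝ im z *ℝ re w)

_·ℂ_ : ℝ → ℂ → ℂ
r ·ℂ z = (r *ℝ re z) +i (r *ℝ im z)

∣_∣ℂ : ℂ → ℝ
∣ z ∣ℂ = √ (re z *ℝ re z +ℝ im z *ℝ im z)

sumℂ : List ℂ → ℂ
sumℂ = List.foldr _+ℂ_ 0ℂ

------------------------------------------------------------------------
-- Characters

-- Characters with values in the unit circle.
record Character {a ℓ} (G : AbelianGroup a ℓ) : Set (a ⊔ˡ ℓ) where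
  open AbelianGroup G
  field
    ⟦_⟧  : Carrier → ℂ
    resp : ∀ {x y} → x ≈ y → ⟦ x ⟧ ≃ℂ ⟦ y ⟧
    homo : ∀ x y → ⟦ x ∙ y ⟧ ≃ℂ ⟦ x ⟧ *ℂ ⟦ y ⟧
    unit : ∀ x → ∣ ⟦ x ⟧ ∣ℂ ≃ℝ 1ℝ

  Nontrivial : Set a
  Nontrivial = ¬ (∀ x → ⟦ x ⟧ ≃ℂ 1ℂ)

------------------------------------------------------------------------
-- Finite rings

record FiniteRing c ℓ : Set (lsuc (c ⊔ˡ ℓ)) where
  field
    ring : Ring c ℓ

  open Ring ring public

  field
    1≉0  : ¬ (1# ≈ 0#)
    size : ℕ
    enum : Inverse setoid (≡.setoid (Fin size))

  size-nonZero : ℕ.NonZero size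
  size-nonZero = Finₚ.nonZeroIndex (Inverse.to enum 0#)

  _≈?_ : Decidable₂ _≈_
  _≈?_ = via-injection (Inverse⇒Injection enum) Finₚ._≟_

  power : ℕ → AbelianGroup c ℓ
  power d = Pointwise.abelianGroup (Fin d) +-abelianGroup

  points : ∀ d → List (Fin d → Carrier)
  points d = List.map (λ k → Inverse.from enum ∘ finToFun k) (List.allFin (size ℕ.^ d))

module _ {c ℓ} (R : FiniteRing c ℓ) (d : ℕ) where
  open FiniteRing R using (Carrier; size; size-nonZero; power; points)

  1/∣R∣^d : ℚ
  1/∣R∣^d = (+ 1 / (size ℕ.^ d)) {{ℕₚ.m^n≢0 size d {{size-nonZero}}}}

  module _ {p} {S : Pred (Fin d → Carrier) p} (S? : Decidable S) where

    card : ℕ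
    card = List.length (List.filter S? (points d))

    fourier : Character (power d) → ℂ
    fourier ψ = fromℚ 1/∣R∣^d ·ℂ sumℂ (List.map ⟦_⟧ (List.filter S? (points d)))
      where open Character ψ

    IsSalem : ℝ → Set (c ⊔ˡ ℓ)
    IsSalem C = ∀ (ψ : Character (power d)) → Character.Nontrivial ψ →
      ∣ fourier ψ ∣ℂ ≤ℝ C *ℝ fromℚ 1/∣R∣^d *ℝ √ (fromℕʳ card)

------------------------------------------------------------------------
-- Integer polynomials in n noncommuting variables

-- A formal ℤ-linear combination of words; a word may be listed several times.
Polynomial : ℕ → Set
Polynomial n = List (ℤ × List (Fin n))

constantTerm : ∀ {n} → Polynomial n → ℤ
constantTerm []                = ℤ.0ℤ
constantTerm ((a , [])    ∷ f) = a ℤ.+ constantTerm f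
constantTerm ((a , _ ∷ _) ∷ f) = constantTerm f

module _ {c ℓ} (R : Ring c ℓ) where
  open Ring R renaming (_+_ to _+ᴿ_; _*_ to _*ᴿ_; -_ to -ᴿ_)
  open Mult +-monoid using () renaming (_×_ to _×ᴿ_)

  _·ℤ_ : ℤ → Carrier → Carrier
  (+ n)    ·ℤ x = n ×ᴿ x
  -[1+ n ] ·ℤ x = -ᴿ (suc n ×ᴿ x)

  evalWord : ∀ {n} → List (Fin n) → (Fin n → Carrier) → Carrier
  evalWord w x = List.foldr (λ i y → x i *ᴿ y) 1# w

  eval : ∀ {n} → Polynomial n → (Fin n → Carrier) → Carrier
  eval f x = List.foldr (λ (a , w) y → (a ·ℤ evalWord w x) +ᴿ y) 0# f

module _ {n} (f : Polynomial n) (c : ℤ) {a ℓ} (R : FiniteRing a ℓ) where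
  open FiniteRing R using (ring; Carrier; _≈_; _≈?_; 1#) renaming (_+_ to _+ᴿ_)

  -- The last coordinate x_d is x (fromℕ n), with d = n + 1.
  V : Pred (Fin (suc n) → Carrier) ℓ
  V x = x (fromℕ n) ≈ eval ring f (x ∘ inject₁) +ᴿ (_·ℤ_ ring c 1#)

  V? : Decidable V
  V? x = x (fromℕ n) ≈? (eval ring f (x ∘ inject₁) +ᴿ (_·ℤ_ ring c 1#))

  ∣V∣ : ℕ
  ∣V∣ = card R (suc n) V?

  IsSalemNumber : ℝ → Set (a ⊔ˡ ℓ)
  IsSalemNumber C = IsSalem R (suc n) V? C × (∀ C′ → IsSalem R (suc n) V? C′ → C ≤ℝ C′)

------------------------------------------------------------------------
-- Product decompositions

module _ {c ℓ c₁ ℓ₁ c₂ ℓ₂} (R : FiniteRing c ℓ)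
         (R₁ : FiniteRing c₁ ℓ₁) (R₂ : FiniteRing c₂ ℓ₂) where
  private
    module R  = FiniteRing R
    module R₁ = FiniteRing R₁
    module R₂ = FiniteRing R₂

  record ProductDecomposition : Set (c ⊔ˡ ℓ ⊔ˡ c₁ ⊔ˡ ℓ₁ ⊔ˡ c₂ ⊔ˡ ℓ₂) where
    open RingMorphisms R.rawRing (Ring.rawRing (DirectProduct.ring R₁.ring R₂.ring))
    field
      to    : R.Carrier → R₁.Carrier × R₂.Carrier
      isIso : IsRingIsomorphism to

{-# OPTIONS --safe #-}

-- The Salem condition with constant C says |Σ_{x ∈ S} ψ(x)| ≤ C √|S| for every nontrivial ψ.
-- A character ψ of R^d = R₁^d × R₂^d is the product of its restrictions ψ₁ and ψ₂, and
-- V(R) = V(R₁) × V(R₂), so Σ ψ = Σ ψ₁ · Σ ψ₂.  If ψ₁ is nontrivial, the trivial bound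
-- |Σ ψ₂| ≤ |V(R₂)| gives |Σ ψ| ≤ C₁ √|V(R₂)| · √|V(R)|, and symmetrically for ψ₂; one of the two
-- is nontrivial, up to a double negation that ≤ℝ absorbs.  Conversely, applying a Salem constant C
-- of R to ψ₁ ⊗ 1 shows that C / √|V(R₂)| is a Salem constant of R₁, whence C₁ √|V(R₂)| ≤ C.
-- The division is possible because V(R₂) = ∅ would make C₂ − 1 a Salem constant too.

module Submission where

open import Defs

module Reals where

  open import Algebra.Bundles using (CommutativeSemiring)
  open import Algebra.Structures.Biased using (isCommutativeSemiringˡ)
  open import Data.Nat.Base as ℕ using (ℕ)
  import Data.Nat.Properties as ℕₚ
  open import Data.Product.Base using (∃-syntax; _×_; _,_)
  open import Data.Rational.Base
  open import Data.Rational.Properties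
  open import Data.Rational.Solver using (module +-*-Solver)
  open import Data.Sum.Base using (_⊎_; inj₁; inj₂)
  open import Level using (0ℓ)
  open import Relation.Binary.Bundles using (Preorder)
  open import Relation.Binary.PropositionalEquality as ≡ using (_≡_; cong; cong₂; subst; subst₂)
  open import Relation.Nullary.Decidable using (Dec; yes; no)
  open import Relation.Nullary.Negation.Core using (¬_; contradiction)

  infix 4 _≈_ _≼_

  -- ≃ℝ and ≤ℝ unfold to Π-types from which Agda cannot recover the two reals;
  -- the record wrappers keep them inferable.
  record _≼_ (x y : ℝ) : Set where
    constructor mk≼
    field un≼ : x ≤ℝ y

  record _≈_ (x y : ℝ) : Set where
    constructor mk≈
    field un≈ : x ≃ℝ y

  open _≼_ public
  open _≈_ public

  private
    variable
      x y z w : ℝ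

  module Rational where
    open +-*-Solver

    [p+q]+q : ∀ p e → (p + ½ * e) + ½ * e ≡ p + e
    [p+q]+q p e = ≡.trans (+-assoc p (½ * e) (½ * e)) (cong (p +_) (½*p+½*p≡p e))

    [p+s]+[q+s] : ∀ p q s → (p + s) + (q + s) ≡ (p + q) + (s + s)
    [p+s]+[q+s] = solve 3 (λ p q s → (p :+ s) :+ (q :+ s) := (p :+ q) :+ (s :+ s)) ≡.refl

    quarter : ∀ {ε} → 0ℚ < ε → ∃[ η ] (0ℚ < η × (η + η + η) + η ≡ ε)
    quarter {ε} 0<ε = let η , 0<η , 4η≡ε = shrink (positive⁻¹ 4ℚ) 0<ε in η , 0<η , ≡.trans (4p η) 4η≡ε
      where
      4ℚ = 1ℚ + 1ℚ + 1ℚ + 1ℚ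
      4p : ∀ p → (p + p + p) + p ≡ 4ℚ * p
      4p = solve 1 (λ p → (p :+ p :+ p) :+ p := con 4ℚ :* p) ≡.refl

    q+[p-q] : ∀ p q → q + (p - q) ≡ p
    q+[p-q] = solve 2 (λ p q → q :+ (p :- q) := p) ≡.refl

    [p+q]² : ∀ p q → (p + q) * (p + q) ≡ p * p + ((p + p) + q) * q
    [p+q]² = solve 2 (λ p q → (p :+ q) :* (p :+ q) := p :* p :+ ((p :+ p) :+ q) :* q) ≡.refl

    p<p+q : ∀ p {q} → 0ℚ < q → p < p + q
    p<p+q p {q} 0<q = subst (_< p + q) (+-identityʳ p) (+-monoʳ-< p 0<q)

    q+[[p-q]+e] : ∀ p q e → q + ((p - q) + e) ≡ p + e
    q+[[p-q]+e] = solve 3 (λ p q e → q :+ ((p :- q) :+ e) := p :+ e) ≡.refl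

    [p+q]-q : ∀ p q → (p + q) - q ≡ p
    [p+q]-q = solve 2 (λ p q → (p :+ q) :- q := p) ≡.refl

    +-cancelʳ-< : ∀ r {p q} → p + r < q + r → p < q
    +-cancelʳ-< r {p} {q} p+r<q+r = subst₂ _<_ ([p+q]-q p r) ([p+q]-q q r) (+-monoˡ-< (- r) p+r<q+r)

    *-distrib-- : ∀ p q r → p * (q - r) ≡ p * q - p * r
    *-distrib-- = solve 3 (λ p q r → p :* (q :- r) := p :* q :- p :* r) ≡.refl

    [q+p]²-q² : ∀ p q → p * p + (q * p + q * p) ≡ (q + p) * (q + p) - q * q
    [q+p]²-q² = solve 2 (λ p q → p :* p :+ (q :* p :+ q :* p) := (q :+ p) :* (q :+ p) :- q :* q) ≡.refl

    [p-q]²+2pq : ∀ p q → (p - q) * (p - q) + (p * q + p * q) ≡ p * p + q * q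
    [p-q]²+2pq = solve 2 (λ p q → (p :- q) :* (p :- q) :+ (p :* q :+ p :* q) := p :* p :+ q :* q) ≡.refl

    *ℂ-assoc-re : ∀ a b c d e f → (a * c - b * d) * e - (a * d + b * c) * f ≡
                                  a * (c * e - d * f) - b * (c * f + d * e)
    *ℂ-assoc-re = solve 6 (λ a b c d e f → (a :* c :- b :* d) :* e :- (a :* d :+ b :* c) :* f :=
      a :* (c :* e :- d :* f) :- b :* (c :* f :+ d :* e)) ≡.refl

    *ℂ-assoc-im : ∀ a b c d e f → (a * c - b * d) * f + (a * d + b * c) * e ≡
                                  a * (c * f + d * e) + b * (c * e - d * f)
    *ℂ-assoc-im = solve 6 (λ a b c d e f → (a :* c :- b :* d) :* f :+ (a :* d :+ b :* c) :* e :=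
      a :* (c :* f :+ d :* e) :+ b :* (c :* e :- d :* f)) ≡.refl

    *ℂ-comm-re : ∀ a b c d → a * c - b * d ≡ c * a - d * b
    *ℂ-comm-re = solve 4 (λ a b c d → a :* c :- b :* d := c :* a :- d :* b) ≡.refl

    *ℂ-comm-im : ∀ a b c d → a * d + b * c ≡ c * b + d * a
    *ℂ-comm-im = solve 4 (λ a b c d → a :* d :+ b :* c := c :* b :+ d :* a) ≡.refl

    *ℂ-identity-re : ∀ a b → 1ℚ * a - 0ℚ * b ≡ a
    *ℂ-identity-re = solve 2 (λ a b → con 1ℚ :* a :- con 0ℚ :* b := a) ≡.refl

    *ℂ-identity-im : ∀ a b → 1ℚ * b + 0ℚ * a ≡ b
    *ℂ-identity-im = solve 2 (λ a b → con 1ℚ :* b :+ con 0ℚ :* a := b) ≡.refl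

    *ℂ-distribʳ-re : ∀ a b c d e f → (c + e) * a - (d + f) * b ≡ (c * a - d * b) + (e * a - f * b)
    *ℂ-distribʳ-re = solve 6 (λ a b c d e f → (c :+ e) :* a :- (d :+ f) :* b :=
      (c :* a :- d :* b) :+ (e :* a :- f :* b)) ≡.refl

    *ℂ-distribʳ-im : ∀ a b c d e f → (c + e) * b + (d + f) * a ≡ (c * b + d * a) + (e * b + f * a)
    *ℂ-distribʳ-im = solve 6 (λ a b c d e f → (c :+ e) :* b :+ (d :+ f) :* a :=
      (c :* b :+ d :* a) :+ (e :* b :+ f :* a)) ≡.refl

    p-0*0 : ∀ p → p - 0ℚ * 0ℚ ≡ p
    p-0*0 = solve 1 (λ p → p :- con 0ℚ :* con 0ℚ := p) ≡.refl

    p*0+0*q : ∀ p q → p * 0ℚ + 0ℚ * q ≡ 0ℚ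
    p*0+0*q = solve 2 (λ p q → p :* con 0ℚ :+ con 0ℚ :* q := con 0ℚ) ≡.refl

    *ℂ-zero-re : ∀ a b → 0ℚ * a - 0ℚ * b ≡ 0ℚ
    *ℂ-zero-re = solve 2 (λ a b → con 0ℚ :* a :- con 0ℚ :* b := con 0ℚ) ≡.refl

    *ℂ-zero-im : ∀ a b → 0ℚ * b + 0ℚ * a ≡ 0ℚ
    *ℂ-zero-im = solve 2 (λ a b → con 0ℚ :* b :+ con 0ℚ :* a := con 0ℚ) ≡.refl

    neg-² : ∀ p → (- p) * (- p) ≡ p * p
    neg-² = solve 1 (λ p → (:- p) :* (:- p) := p :* p) ≡.refl

    neg-antimono-<-+ : ∀ {p q r} → p < q + r → - q < - p + r
    neg-antimono-<-+ {p} {q} {r} p<q+r =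
      subst₂ _<_ ([-q-p]+p p q) ([-q-p]+[q+r] p q r) (+-monoʳ-< (- q - p) p<q+r)
      where
      [-q-p]+p : ∀ p q → (- q - p) + p ≡ - q
      [-q-p]+p = solve 2 (λ p q → (:- q :- p) :+ p := :- q) ≡.refl
      [-q-p]+[q+r] : ∀ p q r → (- q - p) + (q + r) ≡ - p + r
      [-q-p]+[q+r] = solve 3 (λ p q r → (:- q :- p) :+ (q :+ r) := :- p :+ r) ≡.refl

    0≤p² : ∀ p → 0ℚ ≤ p * p
    0≤p² p with ≤-total 0ℚ p
    ... | inj₁ 0≤p = *-nonNeg 0≤p 0≤p
    ... | inj₂ p≤0 = subst (0ℚ ≤_) (neg-² p) (*-nonNeg (neg-antimono-≤ p≤0) (neg-antimono-≤ p≤0))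

    ⊔-pres-< : ∀ {p q r} → p < r → q < r → p ⊔ q < r
    ⊔-pres-< {p} {q} p<r q<r with ⊔-sel p q
    ... | inj₁ eq = subst (_< _) (≡.sym eq) p<r
    ... | inj₂ eq = subst (_< _) (≡.sym eq) q<r

    2pq≤p²+q² : ∀ p q → p * q + p * q ≤ p * p + q * q
    2pq≤p²+q² p q = subst₂ _≤_ (+-identityˡ (p * q + p * q)) ([p-q]²+2pq p q)
      (+-monoˡ-≤ (p * q + p * q) (0≤p² (p - q)))

  open Rational

  pointwise-≤ : (∀ n → seq x n ≤ seq y n) → x ≼ y
  pointwise-≤ {x} {y} x≤y = mk≼ λ ε 0<ε → 0 , λ n _ →
    ≤-<-trans (x≤y n) (subst (_< seq y n + ε) (+-identityʳ (seq y n)) (+-monoʳ-< (seq y n) 0<ε))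

  ≈⇒≼ : x ≈ y → x ≼ y
  ≈⇒≼ {x} {y} x≈y = mk≼ λ ε 0<ε → let N , h = un≈ x≈y ε 0<ε in N , λ n N≤n →
    ≤-<-trans (p≤q+∣p-q∣ (seq x n) (seq y n)) (+-monoʳ-< (seq y n) (h n N≤n))

  ≈-sym : x ≈ y → y ≈ x
  ≈-sym {x} {y} x≈y = mk≈ λ ε 0<ε → let N , h = un≈ x≈y ε 0<ε in N , λ n N≤n →
    subst (_< ε) (∣p-q∣≡∣q-p∣ (seq x n) (seq y n)) (h n N≤n)

  ≼-antisym : x ≼ y → y ≼ x → x ≈ y
  ≼-antisym x≼y y≼x = mk≈ λ ε 0<ε →
    let M , h = un≼ x≼y ε 0<ε
        N , k = un≼ y≼x ε 0<ε
    in M ℕ.⊔ N , λ n K≤n → ∣p-q∣<r (h n (≤₁ M N K≤n)) (k n (≤₂ M N K≤n))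

  pointwise-≡ : (∀ n → seq x n ≡ seq y n) → x ≈ y
  pointwise-≡ x≡y = ≼-antisym (pointwise-≤ λ n → ≤-reflexive (x≡y n))
                              (pointwise-≤ λ n → ≤-reflexive (≡.sym (x≡y n)))

  ≈-refl : x ≈ x
  ≈-refl = pointwise-≡ λ _ → ≡.refl

  ≼-trans : x ≼ y → y ≼ z → x ≼ z
  ≼-trans {x} {y} {z} x≼y y≼z = mk≼ λ ε 0<ε →
    let M , h = un≼ x≼y (½ * ε) (0<½*p 0<ε)
        N , k = un≼ y≼z (½ * ε) (0<½*p 0<ε)
    in M ℕ.⊔ N , λ n K≤n → subst (seq x n <_) ([p+q]+q (seq z n) ε)
         (<-trans (h n (≤₁ M N K≤n)) (+-monoˡ-< (½ * ε) (k n (≤₂ M N K≤n))))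

  ≈-trans : x ≈ y → y ≈ z → x ≈ z
  ≈-trans x≈y y≈z = ≼-antisym (≼-trans (≈⇒≼ x≈y) (≈⇒≼ y≈z))
                              (≼-trans (≈⇒≼ (≈-sym y≈z)) (≈⇒≼ (≈-sym x≈y)))

  ≼-preorder : Preorder 0ℓ 0ℓ 0ℓ
  ≼-preorder = record
    { Carrier = ℝ ; _≈_ = _≈_ ; _≲_ = _≼_
    ; isPreorder = record
      { isEquivalence = record { refl = ≈-refl ; sym = ≈-sym ; trans = ≈-trans }
      ; reflexive = ≈⇒≼
      ; trans = ≼-trans
      }
    }

  module ≼-Reasoning where
    open import Relation.Binary.Reasoning.Preorder ≼-preorder public

  +-mono-≼ : x ≼ y → z ≼ w → x +ℝ z ≼ y +ℝ w
  +-mono-≼ {x} {y} {z} {w} x≼y z≼w = mk≼ λ ε 0<ε →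
    let M , h = un≼ x≼y (½ * ε) (0<½*p 0<ε)
        N , k = un≼ z≼w (½ * ε) (0<½*p 0<ε)
    in M ℕ.⊔ N , λ n K≤n → subst (seq x n + seq z n <_)
         (≡.trans ([p+s]+[q+s] (seq y n) (seq w n) (½ * ε)) (cong (seq y n + seq w n +_) (½*p+½*p≡p ε)))
         (+-mono-< (h n (≤₁ M N K≤n)) (k n (≤₂ M N K≤n)))

  +-cong : x ≈ y → z ≈ w → x +ℝ z ≈ y +ℝ w
  +-cong {x} {y} {z} {w} x≈y z≈w = ≼-antisym
    (+-mono-≼ {x} {y} {z} {w} (≈⇒≼ x≈y) (≈⇒≼ z≈w))
    (+-mono-≼ {y} {x} {w} {z} (≈⇒≼ (≈-sym x≈y)) (≈⇒≼ (≈-sym z≈w)))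

  *-cong : x ≈ y → z ≈ w → x *ℝ z ≈ y *ℝ w
  *-cong {x} {y} {z} {w} x≈y z≈w = mk≈ λ ε 0<ε →
    let A , 0<A , N₁ , hA = bounded x
        B , 0<B , N₂ , hB = bounded w
        α , 0<α , Aα≡½ε = shrink 0<A (0<½*p 0<ε)
        β , 0<β , Bβ≡½ε = shrink 0<B (0<½*p 0<ε)
        N₃ , hz = un≈ z≈w α 0<α
        N₄ , hx = un≈ x≈y β 0<β
    in (N₁ ℕ.⊔ N₂) ℕ.⊔ (N₃ ℕ.⊔ N₄) , λ n K≤n →
       let K₁≤n = ≤₁ (N₁ ℕ.⊔ N₂) (N₃ ℕ.⊔ N₄) K≤n
           K₂≤n = ≤₂ (N₁ ℕ.⊔ N₂) (N₃ ℕ.⊔ N₄) K≤n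
       in subst (∣ seq x n * seq z n - seq y n * seq w n ∣ <_)
            (≡.trans (cong₂ _+_ Aα≡½ε Bβ≡½ε) (½*p+½*p≡p ε))
            (∣ab-cd∣< (seq x n) (seq z n) (seq y n) (seq w n) 0<A 0<B
              (hA n (≤₁ N₁ N₂ K₁≤n)) (hz n (≤₁ N₃ N₄ K₂≤n))
              (hB n (≤₂ N₁ N₂ K₁≤n)) (hx n (≤₂ N₃ N₄ K₂≤n)))

  ℝ-commutativeSemiring : CommutativeSemiring 0ℓ 0ℓ
  ℝ-commutativeSemiring = record
    { Carrier = ℝ ; _≈_ = _≈_ ; _+_ = _+ℝ_ ; _*_ = _*ℝ_ ; 0# = 0ℝ ; 1# = 1ℝ
    ; isCommutativeSemiring = isCommutativeSemiringˡ record
      { +-isCommutativeMonoid = record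
        { isMonoid = record
          { isSemigroup = record
            { isMagma = record { isEquivalence = Preorder.isEquivalence ≼-preorder ; ∙-cong = λ {x} {y} {z} {w} → +-cong {x} {y} {z} {w} }
            ; assoc = λ x y z → pointwise-≡ λ n → +-assoc (seq x n) (seq y n) (seq z n)
            }
          ; identity = (λ x → pointwise-≡ λ n → +-identityˡ (seq x n))
                     , (λ x → pointwise-≡ λ n → +-identityʳ (seq x n))
          }
        ; comm = λ x y → pointwise-≡ λ n → +-comm (seq x n) (seq y n)
        }
      ; *-isCommutativeMonoid = record
        { isMonoid = record
          { isSemigroup = record
            { isMagma = record { isEquivalence = Preorder.isEquivalence ≼-preorder ; ∙-cong = λ {x} {y} {z} {w} → *-cong {x} {y} {z} {w} }
            ; assoc = λ x y z → pointwise-≡ λ n → *-assoc (seq x n) (seq y n) (seq z n)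
            }
          ; identity = (λ x → pointwise-≡ λ n → *-identityˡ (seq x n))
                     , (λ x → pointwise-≡ λ n → *-identityʳ (seq x n))
          }
        ; comm = λ x y → pointwise-≡ λ n → *-comm (seq x n) (seq y n)
        }
      ; distribʳ = λ x y z → pointwise-≡ λ n → *-distribʳ-+ (seq x n) (seq y n) (seq z n)
      ; zeroˡ = λ x → pointwise-≡ λ n → *-zeroˡ (seq x n)
      }
    }

  -ℝ-mono-≼ : x ≼ y → w ≼ z → x -ℝ z ≼ y -ℝ w
  -ℝ-mono-≼ {x} {y} {w} {z} x≼y w≼z = mk≼ λ ε 0<ε →
    let M , h = un≼ x≼y (½ * ε) (0<½*p 0<ε)
        N , k = un≼ w≼z (½ * ε) (0<½*p 0<ε)
    in M ℕ.⊔ N , λ n K≤n → subst (seq x n - seq z n <_)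
         (≡.trans ([p+s]+[q+s] (seq y n) (- seq w n) (½ * ε)) (cong (seq y n - seq w n +_) (½*p+½*p≡p ε)))
         (+-mono-< (h n (≤₁ M N K≤n)) (neg-antimono-<-+ (k n (≤₂ M N K≤n))))

  -ℝ-cong : x ≈ y → z ≈ w → x -ℝ z ≈ y -ℝ w
  -ℝ-cong {x} {y} {z} {w} x≈y z≈w = ≼-antisym
    (-ℝ-mono-≼ {x} {y} {w} {z} (≈⇒≼ x≈y) (≈⇒≼ (≈-sym z≈w)))
    (-ℝ-mono-≼ {y} {x} {z} {w} (≈⇒≼ (≈-sym x≈y)) (≈⇒≼ z≈w))

  x≼y⇒0≼y-x : x ≼ y → 0ℝ ≼ y -ℝ x
  x≼y⇒0≼y-x {x} {y} x≼y = ≼-trans {y = x -ℝ x}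
    (≈⇒≼ (pointwise-≡ λ n → ≡.sym (+-inverseʳ (seq x n)))) (-ℝ-mono-≼ {x} {y} {x} {x} x≼y (≈⇒≼ ≈-refl))

  0≼y-x⇒x≼y : 0ℝ ≼ y -ℝ x → x ≼ y
  0≼y-x⇒x≼y {y} {x} 0≼y-x = mk≼ λ ε 0<ε → let N , h = un≼ 0≼y-x ε 0<ε in N , λ n N≤n →
    subst₂ _<_ (+-identityʳ (seq x n)) (q+[[p-q]+e] (seq y n) (seq x n) ε) (+-monoʳ-< (seq x n) (h n N≤n))

  0≼x+y : 0ℝ ≼ x → 0ℝ ≼ y → 0ℝ ≼ x +ℝ y
  0≼x+y {x} {y} 0≼x 0≼y = ≼-trans {y = 0ℝ +ℝ 0ℝ} (pointwise-≤ λ _ → ≤-refl)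
    (+-mono-≼ {0ℝ} {x} {0ℝ} {y} 0≼x 0≼y)

  0≼x⇒0⊔x≈x : 0ℝ ≼ x → 0ℝ ⊔ℝ x ≈ x
  0≼x⇒0⊔x≈x {x} 0≼x = ≼-antisym
    (mk≼ λ ε 0<ε → let N , h = un≼ 0≼x ε 0<ε in N , λ n N≤n →
      ⊔-pres-< (h n N≤n) (p<p+q (seq x n) 0<ε))
    (pointwise-≤ λ n → p≤q⊔p 0ℚ (seq x n))

  x≼x⊔y : ∀ x y → x ≼ x ⊔ℝ y
  x≼x⊔y x y = pointwise-≤ λ n → p≤p⊔q (seq x n) (seq y n)

  y≼x⊔y : ∀ x y → y ≼ x ⊔ℝ y
  y≼x⊔y x y = pointwise-≤ λ n → p≤q⊔p (seq x n) (seq y n)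

  ⊔ℝ-lub : x ≼ z → y ≼ z → x ⊔ℝ y ≼ z
  ⊔ℝ-lub {x} {z} {y} x≼z y≼z = mk≼ λ ε 0<ε →
    let M , h = un≼ x≼z ε 0<ε
        N , k = un≼ y≼z ε 0<ε
    in M ℕ.⊔ N , λ n K≤n → ⊔-pres-< (h n (≤₁ M N K≤n)) (k n (≤₂ M N K≤n))

  -- Comparing a rational approximation of x, within η, with 2η decides which alternative holds.
  ≼-or-≽ : ∀ x {η} → 0ℚ < η → x ≼ fromℚ ((η + η) + η) ⊎ fromℚ η ≼ x
  ≼-or-≽ x {η} 0<η = decide (cauchy x η 0<η)
    where
    open ≤-Reasoning

    decide : ∃[ N ] (∀ m n → N ℕ.≤ m → N ℕ.≤ n → ∣ seq x m - seq x n ∣ < η) →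
             x ≼ fromℚ ((η + η) + η) ⊎ fromℚ η ≼ x
    decide (N , h) = case (seq x N ≤? η + η)
      where
      above : seq x N ≤ η + η → ∀ n → N ℕ.≤ n → seq x n ≤ (η + η) + η
      above x_N≤2η n N≤n = begin
        seq x n                              ≤⟨ p≤q+∣p-q∣ (seq x n) (seq x N) ⟩
        seq x N + ∣ seq x n - seq x N ∣      ≤⟨ +-mono-≤ x_N≤2η (<⇒≤ (h n N N≤n ℕₚ.≤-refl)) ⟩
        (η + η) + η                          ∎

      below : η + η < seq x N → ∀ n → N ℕ.≤ n → η < seq x n
      below 2η<x_N n N≤n = +-cancelʳ-< η (begin-strict
        η + η                              <⟨ 2η<x_N ⟩
        seq x N                            ≤⟨ p≤q+∣p-q∣ (seq x N) (seq x n) ⟩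
        seq x n + ∣ seq x N - seq x n ∣    <⟨ +-monoʳ-< (seq x n) (h N n ℕₚ.≤-refl N≤n) ⟩
        seq x n + η                        ∎)

      case : Dec (seq x N ≤ η + η) → x ≼ fromℚ ((η + η) + η) ⊎ fromℚ η ≼ x
      case (yes x_N≤2η) = inj₁ (mk≼ λ ε 0<ε → N , λ n N≤n →
        ≤-<-trans (above x_N≤2η n N≤n) (p<p+q ((η + η) + η) 0<ε))
      case (no x_N≰2η) = inj₂ (mk≼ λ ε 0<ε → N , λ n N≤n →
        <-trans (below (≰⇒> x_N≰2η) n N≤n) (p<p+q (seq x n) 0<ε))

  ≼-by-contradiction : (∀ {η} → 0ℚ < η → ¬ (fromℚ η ≼ x -ℝ y)) → x ≼ y
  ≼-by-contradiction {x} {y} ¬η≼x-y = mk≼ λ ε 0<ε → approx ε (quarter 0<ε)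
    where
    approx : ∀ ε → ∃[ η ] (0ℚ < η × (η + η + η) + η ≡ ε) →
             ∃[ N ] (∀ n → N ℕ.≤ n → seq x n < seq y n + ε)
    approx ε (η , 0<η , 4η≡ε) = case (≼-or-≽ (x -ℝ y) 0<η)
      where
      case : x -ℝ y ≼ fromℚ ((η + η) + η) ⊎ fromℚ η ≼ x -ℝ y →
             ∃[ N ] (∀ n → N ℕ.≤ n → seq x n < seq y n + ε)
      case (inj₂ η≼x-y) = contradiction η≼x-y (¬η≼x-y 0<η)
      case (inj₁ x-y≼3η) = let N , h = un≼ x-y≼3η η 0<η in N , λ n N≤n →
        subst₂ _<_ (q+[p-q] (seq x n) (seq y n)) (cong (seq y n +_) 4η≡ε)
          (+-monoʳ-< (seq y n) (h n N≤n))

  0≼x*y : 0ℝ ≼ x → 0ℝ ≼ y → 0ℝ ≼ x *ℝ y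
  0≼x*y {x} {y} 0≼x 0≼y = ≼-trans {y = (0ℝ ⊔ℝ x) *ℝ (0ℝ ⊔ℝ y)}
    (pointwise-≤ λ n → *-nonNeg (0≤0⊔ (seq x n)) (0≤0⊔ (seq y n)))
    (≈⇒≼ (*-cong {0ℝ ⊔ℝ x} {x} {0ℝ ⊔ℝ y} {y} (0≼x⇒0⊔x≈x 0≼x) (0≼x⇒0⊔x≈x 0≼y)))

  *-monoˡ-≼ : 0ℝ ≼ x → y ≼ z → x *ℝ y ≼ x *ℝ z
  *-monoˡ-≼ {x} {y} {z} 0≼x y≼z = 0≼y-x⇒x≼y {x *ℝ z} {x *ℝ y}
    (≼-trans {y = x *ℝ (z -ℝ y)} (0≼x*y {x} {z -ℝ y} 0≼x (x≼y⇒0≼y-x {y} {z} y≼z))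
      (≈⇒≼ (pointwise-≡ λ n → *-distrib-- (seq x n) (seq z n) (seq y n))))

  *-monoʳ-≼ : 0ℝ ≼ x → y ≼ z → y *ℝ x ≼ z *ℝ x
  *-monoʳ-≼ {x} {y} {z} 0≼x y≼z = ≼-trans {y = x *ℝ y} (≈⇒≼ (pointwise-≡ λ n → *-comm (seq y n) (seq x n)))
    (≼-trans {y = x *ℝ z} (*-monoˡ-≼ {x} {y} {z} 0≼x y≼z) (≈⇒≼ (pointwise-≡ λ n → *-comm (seq x n) (seq z n))))

  positive⇒⋠0 : ∀ {p} → 0ℚ < p → ¬ (fromℚ p ≼ 0ℝ)
  positive⇒⋠0 {p} 0<p p≼0 = let N , h = un≼ p≼0 p 0<p in
    <-irrefl (≡.sym (+-identityˡ p)) (h N ℕₚ.≤-refl)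

  -- If x − y ≥ η > 0 then x² − y² ≥ η² > 0.
  ²-cancel-≼ : 0ℝ ≼ y → x *ℝ x ≼ y *ℝ y → x ≼ y
  ²-cancel-≼ {y} {x} 0≼y x²≼y² = ≼-by-contradiction {x} {y} λ {η} 0<η η≼x-y →
    let e     = fromℚ η
        0≼e   = pointwise-≤ {0ℝ} {e} λ _ → <⇒≤ 0<η
        0≼y+e = 0≼x+y {y} {e} 0≼y 0≼e
        0≼ye  = 0≼x*y {y} {e} 0≼y 0≼e
        y+e≼x : y +ℝ e ≼ x
        y+e≼x = mk≼ λ ε 0<ε → let N , h = un≼ η≼x-y ε 0<ε in N , λ n N≤n →
          subst (seq y n + η <_) (q+[[p-q]+e] (seq x n) (seq y n) ε) (+-monoʳ-< (seq y n) (h n N≤n))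
        [y+e]²≼y² : (y +ℝ e) *ℝ (y +ℝ e) ≼ y *ℝ y
        [y+e]²≼y² = ≼-trans {y = (y +ℝ e) *ℝ x} (*-monoˡ-≼ {y +ℝ e} {y +ℝ e} {x} 0≼y+e y+e≼x)
          (≼-trans {y = x *ℝ x} (*-monoʳ-≼ {x} {y +ℝ e} {x} (≼-trans 0≼y+e y+e≼x) y+e≼x) x²≼y²)
    in positive⇒⋠0 (*-pos 0<η 0<η)
      (≼-trans {y = e *ℝ e +ℝ (y *ℝ e +ℝ y *ℝ e)}
        (≼-trans {y = e *ℝ e +ℝ 0ℝ} (pointwise-≤ λ _ → ≤-reflexive (≡.sym (+-identityʳ (η * η))))
          (+-mono-≼ {e *ℝ e} {e *ℝ e} {0ℝ} {y *ℝ e +ℝ y *ℝ e} (≈⇒≼ ≈-refl)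
            (0≼x+y {y *ℝ e} {y *ℝ e} 0≼ye 0≼ye)))
        (≼-trans {y = (y +ℝ e) *ℝ (y +ℝ e) -ℝ y *ℝ y}
          (≈⇒≼ (pointwise-≡ λ n → [q+p]²-q² η (seq y n)))
          (≼-trans {y = y *ℝ y -ℝ y *ℝ y} (-ℝ-mono-≼ {(y +ℝ e) *ℝ (y +ℝ e)} {y *ℝ y} {y *ℝ y} {y *ℝ y}
              [y+e]²≼y² (≈⇒≼ ≈-refl))
            (pointwise-≤ λ n → ≤-reflexive (+-inverseʳ (seq y n * seq y n))))))

  0≼√ : ∀ x → 0ℝ ≼ √ x
  0≼√ x = pointwise-≤ λ n → /-nonNeg (sqrtNum n (0ℚ ⊔ seq x n)) n

  √-² : 0ℝ ≼ x → √ x *ℝ √ x ≈ x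
  √-² {x} 0≼x = ≈-trans {y = 0ℝ ⊔ℝ x} (≼-antisym
      (pointwise-≤ λ n → sqrtℚ-lower n (0≤0⊔ (seq x n)))
      (mk≼ 0⊔x≤[√x]²))
    (0≼x⇒0⊔x≈x 0≼x)
    where
    0⊔x≤[√x]² : (0ℝ ⊔ℝ x) ≤ℝ (√ x *ℝ √ x)
    0⊔x≤[√x]² ε 0<ε =
      let B , 0<B , N₁ , hB  = bounded (√ x)
          0<1                = positive⁻¹ 1ℚ
          0<2B+1             = +-mono-< (+-mono-< 0<B 0<B) 0<1
          η , 0<η , eq       = shrink 0<2B+1 0<ε
          N₂ , h             = archimedean 0<η
          N₃ , k             = archimedean 0<1
      in N₁ ℕ.⊔ (N₂ ℕ.⊔ N₃) , λ n K≤n →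
         let s   = seq (√ x) n
             δ   = 1/suc n
             K≤n′ = ≤₂ N₁ (N₂ ℕ.⊔ N₃) K≤n
             s≤B = <⇒≤ (≤-<-trans (p≤∣p∣ s) (hB n (≤₁ N₁ (N₂ ℕ.⊔ N₃) K≤n)))
         in begin-strict
           0ℚ ⊔ seq x n               <⟨ sqrtℚ-upper n (0≤0⊔ (seq x n)) ⟩
           (s + δ) * (s + δ)          ≡⟨ [p+q]² s δ ⟩
           s * s + ((s + s) + δ) * δ  ≤⟨ +-monoʳ-≤ (s * s) (*-mono-≤-nonNeg
                                           (+-nonNeg (+-nonNeg (0≤s n) (0≤s n)) (/-nonNeg 1 n)) (<⇒≤ 0<η)
                                           (+-mono-≤ (+-mono-≤ s≤B s≤B) (k n (≤₂ N₂ N₃ K≤n′)))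
                                           (h n (≤₁ N₂ N₃ K≤n′))) ⟩
           s * s + ((B + B) + 1ℚ) * η ≡⟨ cong (s * s +_) eq ⟩
           s * s + ε                  ∎
      where
      open ≤-Reasoning
      0≤s : ∀ n → 0ℚ ≤ seq (√ x) n
      0≤s n = /-nonNeg (sqrtNum n (0ℚ ⊔ seq x n)) n

open import Algebra.Bundles using (CommutativeSemiring)
open import Algebra.Core using (Op₁; Op₂)
open import Algebra.Structures using (IsCommutativeSemiring)
import Algebra.Solver.CommutativeMonoid as CommutativeMonoidSolver
import Algebra.Solver.Ring.NaturalCoefficients.Default as NaturalCoefficientsSolver
open import Level using (0ℓ)
open import Relation.Binary.Core using (Rel)
open import Relation.Binary.Bundles using (Preorder)
open import Relation.Binary.Structures using (IsPreorder)
open import Relation.Binary.Definitions using (Antisymmetric)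

module RootedSemiring
  {A : Set} (_≈_ _≼_ : Rel A 0ℓ) (_+_ _*_ : Op₂ A) (0# 1# : A) (√ : Op₁ A)
  (isCommutativeSemiring : IsCommutativeSemiring _≈_ _+_ _*_ 0# 1#)
  (isPreorder : IsPreorder _≈_ _≼_)
  (≼-antisym  : Antisymmetric _≈_ _≼_)
  (+-mono-≼   : ∀ {x y z w} → x ≼ y → z ≼ w → (x + z) ≼ (y + w))
  (*-monoˡ-≼  : ∀ {x y z} → 0# ≼ x → y ≼ z → (x * y) ≼ (x * z))
  (0≼√        : ∀ x → 0# ≼ √ x)
  (√-²        : ∀ {x} → 0# ≼ x → (√ x * √ x) ≈ x)
  (0≼x²       : ∀ x → 0# ≼ (x * x))
  (2xy≼x²+y²  : ∀ x y → ((x * y) + (x * y)) ≼ ((x * x) + (y * y)))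
  (²-cancel-≼ : ∀ {x y} → 0# ≼ y → (x * x) ≼ (y * y) → x ≼ y)
  where

  private
    variable
      c c₁ k k₁ k₂ m p s s₁ s₂ u v x y z : A
    R : CommutativeSemiring 0ℓ 0ℓ
    R = record { isCommutativeSemiring = isCommutativeSemiring }
    preorder : Preorder 0ℓ 0ℓ 0ℓ
    preorder = record { isPreorder = isPreorder }

  open CommutativeSemiring R using
    (refl; sym; +-cong; *-cong; *-congˡ; *-congʳ; *-comm; *-identityʳ; +-identityʳ; zeroʳ
    ; distribˡ; distribʳ; *-commutativeMonoid; +-commutativeMonoid)
  open IsPreorder isPreorder using () renaming (reflexive to ≼-reflexive; trans to ≼-trans)
  open import Relation.Binary.Reasoning.Preorder preorder

  private
    module * = CommutativeMonoidSolver *-commutativeMonoid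
    module +* = NaturalCoefficientsSolver R
    module + = CommutativeMonoidSolver +-commutativeMonoid

  ≼-refl : x ≼ x
  ≼-refl = ≼-reflexive refl

  *-monoʳ-≼ : 0# ≼ x → y ≼ z → (y * x) ≼ (z * x)
  *-monoʳ-≼ {x} {y} {z} 0≼x y≼z = begin
    y * x  ≈⟨ *-comm y x ⟩
    x * y  ≲⟨ *-monoˡ-≼ 0≼x y≼z ⟩
    x * z  ≈⟨ *-comm x z ⟩
    z * x  ∎

  0≼x+y : 0# ≼ x → 0# ≼ y → 0# ≼ (x + y)
  0≼x+y {x} {y} 0≼x 0≼y = begin
    0#       ≈⟨ +-identityʳ 0# ⟨
    0# + 0#  ≲⟨ +-mono-≼ 0≼x 0≼y ⟩
    x + y    ∎

  0≼x*y : 0# ≼ x → 0# ≼ y → 0# ≼ (x * y)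
  0≼x*y {x} {y} 0≼x 0≼y = begin
    0#       ≈⟨ zeroʳ x ⟨
    x * 0#   ≲⟨ *-monoˡ-≼ 0≼x 0≼y ⟩
    x * y    ∎

  √-mono : 0# ≼ x → x ≼ y → √ x ≼ √ y
  √-mono {x} {y} 0≼x x≼y = ²-cancel-≼ (0≼√ y) (begin
    √ x * √ x  ≈⟨ √-² 0≼x ⟩
    x          ≲⟨ x≼y ⟩
    y          ≈⟨ √-² (≼-trans 0≼x x≼y) ⟨
    √ y * √ y  ∎)

  √-cong : 0# ≼ x → x ≈ y → √ x ≈ √ y
  √-cong 0≼x x≈y = ≼-antisym (√-mono 0≼x (≼-reflexive x≈y))
    (√-mono (≼-trans 0≼x (≼-reflexive x≈y)) (≼-reflexive (sym x≈y)))

  √[x²]≈x : 0# ≼ x → √ (x * x) ≈ x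
  √[x²]≈x {x} 0≼x = ≼-antisym
    (²-cancel-≼ 0≼x (≼-reflexive (√-² (0≼x*y 0≼x 0≼x))))
    (²-cancel-≼ (0≼√ (x * x)) (≼-reflexive (sym (√-² (0≼x*y 0≼x 0≼x)))))

  √-* : 0# ≼ x → 0# ≼ y → √ (x * y) ≈ (√ x * √ y)
  √-* {x} {y} 0≼x 0≼y = begin-equality
    √ (x * y)                      ≈⟨ √-cong (0≼x*y 0≼x 0≼y) (begin-equality
       x * y                          ≈⟨ *-cong (√-² 0≼x) (√-² 0≼y) ⟨
       (√ x * √ x) * (√ y * √ y)      ≈⟨ *.solve 2 (λ a b → (a *.⊕ a) *.⊕ (b *.⊕ b) *.⊜ (a *.⊕ b) *.⊕ (a *.⊕ b)) refl (√ x) (√ y) ⟩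
       (√ x * √ y) * (√ x * √ y)      ∎) ⟩
    √ ((√ x * √ y) * (√ x * √ y))  ≈⟨ √[x²]≈x (0≼x*y (0≼√ x) (0≼√ y)) ⟩
    √ x * √ y                      ∎

  √-minkowski : 0# ≼ x → 0# ≼ y → 0# ≼ ((x + y) + (p + p)) → (p * p) ≼ (x * y) →
                √ ((x + y) + (p + p)) ≼ (√ x + √ y)
  √-minkowski {x} {y} {p} 0≼x 0≼y 0≼t p²≼xy = ²-cancel-≼ (0≼x+y (0≼√ x) (0≼√ y)) (begin
    √ ((x + y) + (p + p)) * √ ((x + y) + (p + p))
      ≈⟨ √-² 0≼t ⟩
    (x + y) + (p + p)
      ≲⟨ +-mono-≼ ≼-refl (+-mono-≼ p≼ab p≼ab) ⟩
    (x + y) + ((a * b) + (a * b))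
      ≈⟨ +-cong (+-cong (√-² 0≼x) (√-² 0≼y)) refl ⟨
    ((a * a) + (b * b)) + ((a * b) + (a * b))
      ≈⟨ +.solve 3 (λ p q r → (p +.⊕ q) +.⊕ (r +.⊕ r) +.⊜ (p +.⊕ r) +.⊕ (r +.⊕ q)) refl (a * a) (b * b) (a * b) ⟩
    ((a * a) + (a * b)) + ((a * b) + (b * b))
      ≈⟨ +-cong (distribˡ a a b) (begin-equality
           b * (a + b)        ≈⟨ distribˡ b a b ⟩
           (b * a) + (b * b)  ≈⟨ +-cong (*-comm b a) refl ⟩
           (a * b) + (b * b)  ∎) ⟨
    (a * (a + b)) + (b * (a + b))
      ≈⟨ distribʳ (a + b) a b ⟨
    (a + b) * (a + b) ∎)
    where
    a = √ x
    b = √ y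
    p≼ab : p ≼ (a * b)
    p≼ab = ²-cancel-≼ (0≼x*y (0≼√ x) (0≼√ y)) (begin
      p * p              ≲⟨ p²≼xy ⟩
      x * y              ≈⟨ √-² (0≼x*y 0≼x 0≼y) ⟨
      √ (x * y) * √ (x * y) ≈⟨ *-cong (√-* 0≼x 0≼y) (√-* 0≼x 0≼y) ⟩
      (a * b) * (a * b)  ∎)

  0≼a²+b² : ∀ a b → 0# ≼ ((a * a) + (b * b))
  0≼a²+b² a b = 0≼x+y (0≼x² a) (0≼x² b)

  modulus-real : ∀ {x} → 0# ≼ x → √ ((x * x) + (0# * 0#)) ≈ x
  modulus-real {x} 0≼x = begin-equality
    √ ((x * x) + (0# * 0#))    ≈⟨ √-cong (0≼a²+b² x 0#) (+-cong refl (zeroʳ 0#)) ⟩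
    √ ((x * x) + 0#)           ≈⟨ √-cong (0≼x+y (0≼x² x) ≼-refl) (+-identityʳ (x * x)) ⟩
    √ (x * x)                  ≈⟨ √[x²]≈x 0≼x ⟩
    x                          ∎

  modulus-cong : ∀ {a b c d} → a ≈ c → b ≈ d → √ ((a * a) + (b * b)) ≈ √ ((c * c) + (d * d))
  modulus-cong {a} {b} a≈c b≈d = √-cong (0≼a²+b² a b) (+-cong (*-cong a≈c a≈c) (*-cong b≈d b≈d))

  modulus-scale : ∀ {r} → 0# ≼ r → ∀ a b → √ (((r * a) * (r * a)) + ((r * b) * (r * b))) ≈ (r * √ ((a * a) + (b * b)))
  modulus-scale {r} 0≼r a b = begin-equality
    √ (((r * a) * (r * a)) + ((r * b) * (r * b)))                ≈⟨ √-cong (0≼a²+b² (r * a) (r * b))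
      (+*.solve 3 (λ r a b → (r :* a) :* (r :* a) :+ (r :* b) :* (r :* b) := (r :* r) :* (a :* a :+ b :* b)) refl r a b) ⟩
    √ ((r * r) * ((a * a) + (b * b)))      ≈⟨ √-* (0≼x² r) (0≼a²+b² a b) ⟩
    √ (r * r) * √ ((a * a) + (b * b))                ≈⟨ *-congʳ (√[x²]≈x 0≼r) ⟩
    r * √ ((a * a) + (b * b))                        ∎
    where open +*

  -- m stands for ac − bd.
  modulus-* : ∀ a b c d {m} →
    ((m * m) + (((a * c) * (b * d)) + ((a * c) * (b * d)))) ≈ (((a * c) * (a * c)) + ((b * d) * (b * d))) →
    √ ((m * m) + (((a * d) + (b * c)) * ((a * d) + (b * c)))) ≈ (√ ((a * a) + (b * b)) * √ ((c * c) + (d * d)))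
  modulus-* a b c d {m} m²+2acbd≈ = begin-equality
    √ ((m * m) + (((a * d) + (b * c)) * ((a * d) + (b * c))))                          ≈⟨ √-cong (0≼a²+b² m ((a * d) + (b * c))) (begin-equality
       (m * m) + (((a * d) + (b * c)) * ((a * d) + (b * c)))  ≈⟨ solve 5 (λ a b c d M →
         M :+ (a :* d :+ b :* c) :* (a :* d :+ b :* c) :=
         (M :+ ((a :* c) :* (b :* d) :+ (a :* c) :* (b :* d))) :+ ((a :* d) :* (a :* d) :+ (b :* c) :* (b :* c)))
         refl a b c d (m * m) ⟩
       _                                                      ≈⟨ +-cong m²+2acbd≈ refl ⟩
       _                                                      ≈⟨ solve 4 (λ a b c d →
         ((a :* c) :* (a :* c) :+ (b :* d) :* (b :* d)) :+ ((a :* d) :* (a :* d) :+ (b :* c) :* (b :* c)) :=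
         (a :* a :+ b :* b) :* (c :* c :+ d :* d)) refl a b c d ⟩
       ((a * a) + (b * b)) * ((c * c) + (d * d))              ∎) ⟩
    √ (((a * a) + (b * b)) * ((c * c) + (d * d)))          ≈⟨ √-* (0≼a²+b² a b) (0≼a²+b² c d) ⟩
    √ ((a * a) + (b * b)) * √ ((c * c) + (d * d))                              ∎
    where open +*

  modulus-triangle : ∀ a b c d → √ (((a + c) * (a + c)) + ((b + d) * (b + d))) ≼ (√ ((a * a) + (b * b)) + √ ((c * c) + (d * d)))
  modulus-triangle a b c d = begin
    √ (((a + c) * (a + c)) + ((b + d) * (b + d)))   ≈⟨ √-cong (0≼a²+b² (a + c) (b + d)) expand ⟩
    √ ((((a * a) + (b * b)) + ((c * c) + (d * d))) + (q + q))
      ≲⟨ √-minkowski (0≼a²+b² a b) (0≼a²+b² c d) (≼-trans (0≼a²+b² (a + c) (b + d)) (≼-reflexive expand)) (begin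
       q * q      ≈⟨ solve 4 (λ a b c d → (a :* c :+ b :* d) :* (a :* c :+ b :* d) :=
         ((a :* c) :* (a :* c) :+ (b :* d) :* (b :* d)) :+ ((a :* d) :* (b :* c) :+ (a :* d) :* (b :* c)))
         refl a b c d ⟩
       _          ≲⟨ +-mono-≼ ≼-refl (2xy≼x²+y² (a * d) (b * c)) ⟩
       _          ≈⟨ solve 4 (λ a b c d →
         ((a :* c) :* (a :* c) :+ (b :* d) :* (b :* d)) :+ ((a :* d) :* (a :* d) :+ (b :* c) :* (b :* c)) :=
         (a :* a :+ b :* b) :* (c :* c :+ d :* d)) refl a b c d ⟩
       ((a * a) + (b * b)) * ((c * c) + (d * d))  ∎) ⟩
    √ ((a * a) + (b * b)) + √ ((c * c) + (d * d)) ∎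
    where
    open +*
    q : A
    q = (a * c) + (b * d)
    expand : (((a + c) * (a + c)) + ((b + d) * (b + d))) ≈ ((((a * a) + (b * b)) + ((c * c) + (d * d))) + (q + q))
    expand = solve 4 (λ a b c d → (a :+ c) :* (a :+ c) :+ (b :+ d) :* (b :+ d) :=
      ((a :* a :+ b :* b) :+ (c :* c :+ d :* d)) :+ ((a :* c :+ b :* d) :+ (a :* c :+ b :* d))) refl a b c d

  √-zero-bound : k ≈ 0# → x ≼ k → ∀ c → x ≼ (c * √ k)
  √-zero-bound {k} {x} k≈0 x≼k c = begin
    x           ≲⟨ x≼k ⟩
    k           ≈⟨ k≈0 ⟩
    0#          ≈⟨ zeroʳ c ⟨
    c * 0#      ≈⟨ *-congˡ (√[x²]≈x ≼-refl) ⟨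
    c * √ (0# * 0#)  ≈⟨ *-congˡ (√-cong (0≼x² 0#) (begin-equality
                          0# * 0#  ≈⟨ zeroʳ 0# ⟩
                          0#       ≈⟨ k≈0 ⟨
                          k        ∎)) ⟩
    c * √ k     ∎

  *-scale-≼ : 0# ≼ v → x ≼ (c * y) → (v * x) ≼ ((c * v) * y)
  *-scale-≼ {v} {x} {c} {y} 0≼v x≼cy = begin
    v * x              ≲⟨ *-monoˡ-≼ 0≼v x≼cy ⟩
    v * (c * y)        ≈⟨ *.solve 3 (λ c v y → v *.⊕ (c *.⊕ y) *.⊜ (c *.⊕ v) *.⊕ y) refl c v y ⟩
    (c * v) * y        ∎

  *-unscale-≼ : 0# ≼ u → (v * u) ≈ 1# → (v * x) ≼ ((c * v) * y) → x ≼ (c * y)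
  *-unscale-≼ {u} {v} {x} {c} {y} 0≼u vu≈1 vx≼cvy = begin
    x                  ≈⟨ *-identityʳ x ⟨
    x * 1#             ≈⟨ *-congˡ vu≈1 ⟨
    x * (v * u)        ≈⟨ *.solve 3 (λ x v u → x *.⊕ (v *.⊕ u) *.⊜ u *.⊕ (v *.⊕ x)) refl x v u ⟩
    u * (v * x)        ≲⟨ *-monoˡ-≼ 0≼u vx≼cvy ⟩
    u * ((c * v) * y)  ≈⟨ *.solve 4 (λ u c v y → u *.⊕ ((c *.⊕ v) *.⊕ y) *.⊜ (c *.⊕ y) *.⊕ (v *.⊕ u)) refl u c v y ⟩
    (c * y) * (v * u)  ≈⟨ *-congˡ vu≈1 ⟩
    (c * y) * 1#       ≈⟨ *-identityʳ (c * y) ⟩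
    c * y              ∎

  product-bound : 0# ≼ s₁ → 0# ≼ k₁ → 0# ≼ k₂ → s ≈ (s₁ * s₂) → k ≈ (k₁ * k₂) →
                  s₁ ≼ (c₁ * √ k₁) → s₂ ≼ k₂ → (c₁ * √ k₂) ≼ m → s ≼ (m * √ k)
  product-bound {s₁} {k₁} {k₂} {s} {s₂} {k} {c₁} {m} 0≼s₁ 0≼k₁ 0≼k₂ s≈s₁s₂ k≈k₁k₂ s₁≼ s₂≼k₂ c₁√k₂≼m = begin
    s                            ≈⟨ s≈s₁s₂ ⟩
    s₁ * s₂                      ≲⟨ *-monoˡ-≼ 0≼s₁ s₂≼k₂ ⟩
    s₁ * k₂                      ≲⟨ *-monoʳ-≼ 0≼k₂ s₁≼ ⟩
    (c₁ * √ k₁) * k₂             ≈⟨ *-congˡ (√-² 0≼k₂) ⟨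
    (c₁ * √ k₁) * (√ k₂ * √ k₂)  ≈⟨ *.solve 3 (λ c a b → (c *.⊕ a) *.⊕ (b *.⊕ b) *.⊜ (c *.⊕ b) *.⊕ (a *.⊕ b)) refl c₁ (√ k₁) (√ k₂) ⟩
    (c₁ * √ k₂) * (√ k₁ * √ k₂)  ≲⟨ *-monoʳ-≼ (0≼x*y (0≼√ k₁) (0≼√ k₂)) c₁√k₂≼m ⟩
    m * (√ k₁ * √ k₂)            ≈⟨ *-congˡ (√-* 0≼k₁ 0≼k₂) ⟨
    m * √ (k₁ * k₂)              ≈⟨ *-congˡ (√-cong (0≼x*y 0≼k₁ 0≼k₂) (sym k≈k₁k₂)) ⟩
    m * √ k                      ∎

  factor-bound : 0# ≼ k₁ → 0# ≼ k₂ → 0# ≼ u → (k₂ * u) ≈ 1# → s ≈ (s₁ * k₂) → k ≈ (k₁ * k₂) →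
                 s ≼ (c * √ k) → s₁ ≼ ((c * (√ k₂ * u)) * √ k₁)
  factor-bound {k₁} {k₂} {u} {s} {s₁} {k} {c} 0≼k₁ 0≼k₂ 0≼u k₂u≈1 s≈s₁k₂ k≈k₁k₂ s≼c√k = begin
    s₁                           ≈⟨ *-identityʳ s₁ ⟨
    s₁ * 1#                      ≈⟨ *-congˡ k₂u≈1 ⟨
    s₁ * (k₂ * u)                ≈⟨ *.solve 3 (λ s k u → s *.⊕ (k *.⊕ u) *.⊜ (s *.⊕ k) *.⊕ u) refl s₁ k₂ u ⟩
    (s₁ * k₂) * u                ≈⟨ *-congʳ s≈s₁k₂ ⟨
    s * u                        ≲⟨ *-monoʳ-≼ 0≼u s≼c√k ⟩
    (c * √ k) * u                ≈⟨ *-congʳ (*-congˡ (√-cong (≼-trans (0≼x*y 0≼k₁ 0≼k₂) (≼-reflexive (sym k≈k₁k₂))) k≈k₁k₂)) ⟩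
    (c * √ (k₁ * k₂)) * u        ≈⟨ *-congʳ (*-congˡ (√-* 0≼k₁ 0≼k₂)) ⟩
    (c * (√ k₁ * √ k₂)) * u      ≈⟨ *.solve 4 (λ c a b u → (c *.⊕ (a *.⊕ b)) *.⊕ u *.⊜ (c *.⊕ (b *.⊕ u)) *.⊕ a) refl c (√ k₁) (√ k₂) u ⟩
    (c * (√ k₂ * u)) * √ k₁      ∎

  clear-root : 0# ≼ k → (k * u) ≈ 1# → x ≼ (c * (√ k * u)) → (x * √ k) ≼ c
  clear-root {k} {u} {x} {c} 0≼k ku≈1 x≼ = begin
    x * √ k                    ≲⟨ *-monoʳ-≼ (0≼√ k) x≼ ⟩
    (c * (√ k * u)) * √ k      ≈⟨ *.solve 3 (λ c a u → (c *.⊕ (a *.⊕ u)) *.⊕ a *.⊜ c *.⊕ ((a *.⊕ a) *.⊕ u)) refl c (√ k) u ⟩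
    c * ((√ k * √ k) * u)      ≈⟨ *-congˡ (*-congʳ (√-² 0≼k)) ⟩
    c * (k * u)                ≈⟨ *-congˡ ku≈1 ⟩
    c * 1#                     ≈⟨ *-identityʳ c ⟩
    c                          ∎

module Complex where

  open Reals
  open import Algebra.Bundles using (CommutativeSemiring)
  open import Algebra.Structures using (IsCommutativeSemiring)
  open import Algebra.Structures.Biased using (isCommutativeSemiringˡ)
  open import Data.Nat.Base as ℕ using (ℕ; suc)
  open import Data.Integer.Base using (+_)
  open import Data.List.Base as List using (List; []; _∷_; length)
  open import Data.Product.Base using (_×_; _,_; proj₁; proj₂)
  open import Data.Rational.Base
  open import Data.Rational.Properties
  open import Relation.Binary.Structures using (IsEquivalence)
  open import Relation.Binary.Bundles using (Preorder)
  open import Relation.Binary.PropositionalEquality as ≡ using (_≡_)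
  open Rational

  open RootedSemiring _≈_ _≼_ _+ℝ_ _*ℝ_ 0ℝ 1ℝ √
    (CommutativeSemiring.isCommutativeSemiring ℝ-commutativeSemiring)
    (Preorder.isPreorder ≼-preorder) ≼-antisym
    (λ {x} {y} {z} {w} → +-mono-≼ {x} {y} {z} {w})
    (λ {x} {y} {z} → Reals.*-monoˡ-≼ {x} {y} {z})
    Reals.0≼√ √-²
    (λ x → pointwise-≤ λ n → 0≤p² (seq x n))
    (λ x y → pointwise-≤ λ n → 2pq≤p²+q² (seq x n) (seq y n))
    (λ {x} {y} → ²-cancel-≼ {y} {x})
    public hiding (≼-refl; *-monoʳ-≼; 0≼x+y; 0≼x*y)

  infix 4 _≋_

  record _≋_ (z w : ℂ) : Set where
    constructor mk≋
    field
      re≈ : re z ≈ re w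
      im≈ : im z ≈ im w

  open _≋_ public

  ≋⇒≃ℂ : ∀ z w → z ≋ w → z ≃ℂ w
  ≋⇒≃ℂ z w z≋w = un≈ (re≈ z≋w) , un≈ (im≈ z≋w)

  ≃ℂ⇒≋ : ∀ z w → z ≃ℂ w → z ≋ w
  ≃ℂ⇒≋ z w (p , q) = mk≋ (mk≈ p) (mk≈ q)

  ≋-isEquivalence : IsEquivalence _≋_
  ≋-isEquivalence = record
    { refl  = mk≋ ≈-refl ≈-refl
    ; sym   = λ z≋w → mk≋ (≈-sym (re≈ z≋w)) (≈-sym (im≈ z≋w))
    ; trans = λ z≋w w≋v → mk≋ (≈-trans (re≈ z≋w) (re≈ w≋v)) (≈-trans (im≈ z≋w) (im≈ w≋v))
    }

  open IsEquivalence ≋-isEquivalence public using ()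
    renaming (refl to ≋-refl; sym to ≋-sym; trans to ≋-trans)

  +ℂ-cong : ∀ {z w u v} → z ≋ w → u ≋ v → z +ℂ u ≋ w +ℂ v
  +ℂ-cong {z} {w} {u} {v} z≋w u≋v = mk≋
    (+-cong {re z} {re w} {re u} {re v} (re≈ z≋w) (re≈ u≋v))
    (+-cong {im z} {im w} {im u} {im v} (im≈ z≋w) (im≈ u≋v))

  *ℂ-cong : ∀ {z w u v} → z ≋ w → u ≋ v → z *ℂ u ≋ w *ℂ v
  *ℂ-cong {z} {w} {u} {v} z≋w u≋v = mk≋
    (-ℝ-cong {re z *ℝ re u} {re w *ℝ re v} {im z *ℝ im u} {im w *ℝ im v}
      (*-cong {re z} {re w} {re u} {re v} (re≈ z≋w) (re≈ u≋v))
      (*-cong {im z} {im w} {im u} {im v} (im≈ z≋w) (im≈ u≋v)))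
    (+-cong {re z *ℝ im u} {re w *ℝ im v} {im z *ℝ re u} {im w *ℝ re v}
      (*-cong {re z} {re w} {im u} {im v} (re≈ z≋w) (im≈ u≋v))
      (*-cong {im z} {im w} {re u} {re v} (im≈ z≋w) (re≈ u≋v)))

  *ℂ-comm : ∀ z w → z *ℂ w ≋ w *ℂ z
  *ℂ-comm z w = mk≋
    (pointwise-≡ λ n → *ℂ-comm-re (seq (re z) n) (seq (im z) n) (seq (re w) n) (seq (im w) n))
    (pointwise-≡ λ n → *ℂ-comm-im (seq (re z) n) (seq (im z) n) (seq (re w) n) (seq (im w) n))

  *ℂ-identityˡ : ∀ z → 1ℂ *ℂ z ≋ z
  *ℂ-identityˡ z = mk≋ (pointwise-≡ λ n → *ℂ-identity-re (seq (re z) n) (seq (im z) n))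
                       (pointwise-≡ λ n → *ℂ-identity-im (seq (re z) n) (seq (im z) n))

  *ℂ-identityʳ : ∀ z → z *ℂ 1ℂ ≋ z
  *ℂ-identityʳ z = ≋-trans {z *ℂ 1ℂ} {1ℂ *ℂ z} {z} (*ℂ-comm z 1ℂ) (*ℂ-identityˡ z)

  ℂ-isCommutativeSemiring : IsCommutativeSemiring _≋_ _+ℂ_ _*ℂ_ 0ℂ 1ℂ
  ℂ-isCommutativeSemiring = isCommutativeSemiringˡ record
    { +-isCommutativeMonoid = record
      { isMonoid = record
        { isSemigroup = record
          { isMagma = record
            { isEquivalence = ≋-isEquivalence ; ∙-cong = λ {z} {w} {u} {v} → +ℂ-cong {z} {w} {u} {v} }
          ; assoc = λ z w v → mk≋
              (pointwise-≡ λ n → +-assoc (seq (re z) n) (seq (re w) n) (seq (re v) n))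
              (pointwise-≡ λ n → +-assoc (seq (im z) n) (seq (im w) n) (seq (im v) n))
          }
        ; identity =
            (λ z → mk≋ (pointwise-≡ λ n → +-identityˡ (seq (re z) n)) (pointwise-≡ λ n → +-identityˡ (seq (im z) n)))
          , (λ z → mk≋ (pointwise-≡ λ n → +-identityʳ (seq (re z) n)) (pointwise-≡ λ n → +-identityʳ (seq (im z) n)))
        }
      ; comm = λ z w → mk≋ (pointwise-≡ λ n → +-comm (seq (re z) n) (seq (re w) n))
                           (pointwise-≡ λ n → +-comm (seq (im z) n) (seq (im w) n))
      }
    ; *-isCommutativeMonoid = record
      { isMonoid = record
        { isSemigroup = record
          { isMagma = record
            { isEquivalence = ≋-isEquivalence ; ∙-cong = λ {z} {w} {u} {v} → *ℂ-cong {z} {w} {u} {v} }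
          ; assoc = λ z w v → mk≋
              (pointwise-≡ λ n → *ℂ-assoc-re (seq (re z) n) (seq (im z) n) (seq (re w) n) (seq (im w) n) (seq (re v) n) (seq (im v) n))
              (pointwise-≡ λ n → *ℂ-assoc-im (seq (re z) n) (seq (im z) n) (seq (re w) n) (seq (im w) n) (seq (re v) n) (seq (im v) n))
          }
        ; identity = *ℂ-identityˡ , *ℂ-identityʳ
        }
      ; comm = *ℂ-comm
      }
    ; distribʳ = λ z w v → mk≋
        (pointwise-≡ λ n → *ℂ-distribʳ-re (seq (re z) n) (seq (im z) n) (seq (re w) n) (seq (im w) n) (seq (re v) n) (seq (im v) n))
        (pointwise-≡ λ n → *ℂ-distribʳ-im (seq (re z) n) (seq (im z) n) (seq (re w) n) (seq (im w) n) (seq (re v) n) (seq (im v) n))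
    ; zeroˡ = λ z → mk≋ (pointwise-≡ λ n → *ℂ-zero-re (seq (re z) n) (seq (im z) n))
                        (pointwise-≡ λ n → *ℂ-zero-im (seq (re z) n) (seq (im z) n))
    }

  ∣∣ℂ-cong : ∀ {z w} → z ≋ w → ∣ z ∣ℂ ≈ ∣ w ∣ℂ
  ∣∣ℂ-cong {z} {w} z≋w = modulus-cong {re z} {im z} {re w} {im w} (re≈ z≋w) (im≈ z≋w)

  ∣∣ℂ-def : ∀ z {x y} → re z ≈ x → im z ≈ y → ∣ z ∣ℂ ≈ √ (x *ℝ x +ℝ y *ℝ y)
  ∣∣ℂ-def z {x} {y} = modulus-cong {re z} {im z} {x} {y}

  ∣r·z∣≈r*∣z∣ : ∀ {r} → 0ℝ ≼ r → ∀ z → ∣ r ·ℂ z ∣ℂ ≈ r *ℝ ∣ z ∣ℂ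
  ∣r·z∣≈r*∣z∣ {r} 0≼r z = begin-equality
    ∣ r ·ℂ z ∣ℂ
      ≈⟨ ∣∣ℂ-def (r ·ℂ z) {r *ℝ re z} {r *ℝ im z} ≈-refl ≈-refl ⟩
    √ ((r *ℝ re z) *ℝ (r *ℝ re z) +ℝ (r *ℝ im z) *ℝ (r *ℝ im z))
      ≈⟨ modulus-scale {r} 0≼r (re z) (im z) ⟩
    r *ℝ √ (re z *ℝ re z +ℝ im z *ℝ im z)
      ≈⟨ *-cong {r} {r} {√ (re z *ℝ re z +ℝ im z *ℝ im z)} {∣ z ∣ℂ} ≈-refl ≈-refl ⟩
    r *ℝ ∣ z ∣ℂ
      ∎
    where open ≼-Reasoning

  [x-y]²+2xy≈x²+y² : ∀ x y → (x -ℝ y) *ℝ (x -ℝ y) +ℝ (x *ℝ y +ℝ x *ℝ y) ≈ x *ℝ x +ℝ y *ℝ y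
  [x-y]²+2xy≈x²+y² x y = pointwise-≡ λ n → [p-q]²+2pq (seq x n) (seq y n)

  ∣z*w∣≈∣z∣*∣w∣ : ∀ z w → ∣ z *ℂ w ∣ℂ ≈ ∣ z ∣ℂ *ℝ ∣ w ∣ℂ
  ∣z*w∣≈∣z∣*∣w∣ z w = begin-equality
    ∣ z *ℂ w ∣ℂ
      ≈⟨ ∣∣ℂ-def (z *ℂ w) {re z *ℝ re w -ℝ im z *ℝ im w} {re z *ℝ im w +ℝ im z *ℝ re w} ≈-refl ≈-refl ⟩
    √ ((re z *ℝ re w -ℝ im z *ℝ im w) *ℝ (re z *ℝ re w -ℝ im z *ℝ im w) +ℝ
       (re z *ℝ im w +ℝ im z *ℝ re w) *ℝ (re z *ℝ im w +ℝ im z *ℝ re w))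
      ≈⟨ modulus-* (re z) (im z) (re w) (im w) {re z *ℝ re w -ℝ im z *ℝ im w}
           ([x-y]²+2xy≈x²+y² (re z *ℝ re w) (im z *ℝ im w)) ⟩
    √ (re z *ℝ re z +ℝ im z *ℝ im z) *ℝ √ (re w *ℝ re w +ℝ im w *ℝ im w)
      ≈⟨ *-cong {√ (re z *ℝ re z +ℝ im z *ℝ im z)} {∣ z ∣ℂ} {√ (re w *ℝ re w +ℝ im w *ℝ im w)} {∣ w ∣ℂ}
           ≈-refl ≈-refl ⟩
    ∣ z ∣ℂ *ℝ ∣ w ∣ℂ
      ∎
    where open ≼-Reasoning

  ∣z+w∣≼∣z∣+∣w∣ : ∀ z w → ∣ z +ℂ w ∣ℂ ≼ ∣ z ∣ℂ +ℝ ∣ w ∣ℂ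
  ∣z+w∣≼∣z∣+∣w∣ z w = begin
    ∣ z +ℂ w ∣ℂ
      ≈⟨ ∣∣ℂ-def (z +ℂ w) {re z +ℝ re w} {im z +ℝ im w} ≈-refl ≈-refl ⟩
    √ ((re z +ℝ re w) *ℝ (re z +ℝ re w) +ℝ (im z +ℝ im w) *ℝ (im z +ℝ im w))
      ≲⟨ modulus-triangle (re z) (im z) (re w) (im w) ⟩
    √ (re z *ℝ re z +ℝ im z *ℝ im z) +ℝ √ (re w *ℝ re w +ℝ im w *ℝ im w)
      ≈⟨ +-cong {√ (re z *ℝ re z +ℝ im z *ℝ im z)} {∣ z ∣ℂ} {√ (re w *ℝ re w +ℝ im w *ℝ im w)} {∣ w ∣ℂ}
           ≈-refl ≈-refl ⟩
    ∣ z ∣ℂ +ℝ ∣ w ∣ℂ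
      ∎
    where open ≼-Reasoning

  0≼∣z∣ : ∀ z → 0ℝ ≼ ∣ z ∣ℂ
  0≼∣z∣ z = Reals.0≼√ (re z *ℝ re z +ℝ im z *ℝ im z)

  0≼fromℕʳ : ∀ k → 0ℝ ≼ fromℕʳ k
  0≼fromℕʳ k = pointwise-≤ λ _ → /-nonNeg k 0

  fromℕʳ-suc : ∀ k → 1ℝ +ℝ fromℕʳ k ≈ fromℕʳ (suc k)
  fromℕʳ-suc k = pointwise-≡ λ _ → ≡.trans (+-comm 1ℚ (+ k / 1)) (1/suc-+ k 0)

  ∣0∣≼0 : ∣ 0ℂ ∣ℂ ≼ 0ℝ
  ∣0∣≼0 = ≈⇒≼ (modulus-real {0ℝ} (≈⇒≼ ≈-refl))

  foldr-map-induction : ∀ {a b p} {A : Set a} {B : Set b} (_∙_ : A → A → A) (ε : A) (f : B → A) (P : A → ℕ → Set p) →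
    P ε 0 → (∀ x {s k} → P s k → P (f x ∙ s) (suc k)) → ∀ xs → P (List.foldr _∙_ ε (List.map f xs)) (length xs)
  foldr-map-induction _∙_ ε f P base step []       = base
  foldr-map-induction _∙_ ε f P base step (x ∷ xs) = step x (foldr-map-induction _∙_ ε f P base step xs)

  module _ {b} {B : Set b} (f : B → ℂ) where

    ∣∑unit∣≼length : (∀ x → ∣ f x ∣ℂ ≈ 1ℝ) → ∀ xs → ∣ sumℂ (List.map f xs) ∣ℂ ≼ fromℕʳ (length xs)
    ∣∑unit∣≼length unit = foldr-map-induction _+ℂ_ 0ℂ f (λ s k → ∣ s ∣ℂ ≼ fromℕʳ k)
      (≼-trans {y = 0ℝ} ∣0∣≼0 (pointwise-≤ λ _ → ≤-refl)) step
      where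
      step : ∀ x {s k} → ∣ s ∣ℂ ≼ fromℕʳ k → ∣ f x +ℂ s ∣ℂ ≼ fromℕʳ (suc k)
      step x {s} {k} ∣s∣≼k = ≼-trans {y = ∣ f x ∣ℂ +ℝ ∣ s ∣ℂ} (∣z+w∣≼∣z∣+∣w∣ (f x) s)
        (≼-trans {y = 1ℝ +ℝ fromℕʳ k}
          (+-mono-≼ {∣ f x ∣ℂ} {1ℝ} {∣ s ∣ℂ} {fromℕʳ k} (≈⇒≼ (unit x)) ∣s∣≼k)
          (≈⇒≼ (fromℕʳ-suc k)))

    ∑1≋length : (∀ x → re (f x) ≈ 1ℝ × im (f x) ≈ 0ℝ) → ∀ xs → sumℂ (List.map f xs) ≋ fromℕʳ (length xs) +i 0ℝ
    ∑1≋length f≋1 = foldr-map-induction _+ℂ_ 0ℂ f (λ s k → s ≋ fromℕʳ k +i 0ℝ)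
      (mk≋ (pointwise-≡ λ _ → ≡.refl) ≈-refl) step
      where
      step : ∀ x {s k} → s ≋ fromℕʳ k +i 0ℝ → f x +ℂ s ≋ fromℕʳ (suc k) +i 0ℝ
      step x {s} {k} s≋k = mk≋
        (≈-trans {y = 1ℝ +ℝ fromℕʳ k}
          (+-cong {re (f x)} {1ℝ} {re s} {fromℕʳ k} (proj₁ (f≋1 x)) (re≈ s≋k))
          (fromℕʳ-suc k))
        (≈-trans {y = 0ℝ +ℝ 0ℝ}
          (+-cong {im (f x)} {0ℝ} {im s} {0ℝ} (proj₂ (f≋1 x)) (im≈ s≋k))
          (pointwise-≡ λ _ → ≡.refl))

open import Algebra.Bundles using (CommutativeSemiring)
open import Algebra.Core using (Op₂)
open import Algebra.Structures using (IsCommutativeSemiring)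
import Algebra.Properties.Semiring.Sum as SemiringSum
open import Data.Bool.Base using (if_then_else_)
open import Data.Fin.Base using (Fin; zero; suc; combine; _↑ˡ_; _↑ʳ_)
open import Data.Fin.Permutation using (Permutation; _⟨$⟩ʳ_)
open import Data.List.Base as List using (List)
open import Data.Nat.Base as ℕ using (ℕ; zero; suc)
open import Data.Product.Base using (_×_; _,_)
open import Function.Base using (_∘_; id)
open import Function.Bundles using (_⇔_; Equivalence)
open import Level using (0ℓ)
open import Relation.Binary.Core using (Rel)
open import Relation.Nullary.Decidable using (Dec; does; yes; no)
open import Relation.Nullary.Negation.Core using (contradiction)
open import Relation.Unary using (Pred; Decidable)

module FiniteSums {A : Set} (_≈_ : Rel A 0ℓ) (_+_ _*_ : Op₂ A) (0# 1# : A)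
  (isCommutativeSemiring : IsCommutativeSemiring _≈_ _+_ _*_ 0# 1#) where

  private
    R : CommutativeSemiring 0ℓ 0ℓ
    R = record { isCommutativeSemiring = isCommutativeSemiring }

  open CommutativeSemiring R using
    (setoid; semiring; refl; sym; trans; +-congˡ; *-cong; +-assoc; +-identityˡ; zeroˡ; zeroʳ)
  open SemiringSum semiring using (sum; sum-cong-≋; sum-permute; *-distribˡ-sum; *-distribʳ-sum)
  open import Relation.Binary.Reasoning.Setoid setoid

  sum-↑ : ∀ m {n} (f : Fin (m ℕ.+ n) → A) → sum f ≈ (sum (λ i → f (i ↑ˡ n)) + sum (λ j → f (m ↑ʳ j)))
  sum-↑ zero    f = sym (+-identityˡ (sum f))
  sum-↑ (suc m) f = trans (+-congˡ (sum-↑ m (f ∘ suc))) (sym (+-assoc _ _ _))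

  sum-combine : ∀ m {n} (f : Fin (m ℕ.* n) → A) → sum f ≈ sum (λ i → sum (λ j → f (combine {m} {n} i j)))
  sum-combine zero        f = refl
  sum-combine (suc m) {n} f = trans (sum-↑ n f) (+-congˡ (sum-combine m (f ∘ (n ↑ʳ_))))

  sum-*-sum : ∀ {m n} (f : Fin m → A) (g : Fin n → A) → sum (λ i → sum (λ j → f i * g j)) ≈ (sum f * sum g)
  sum-*-sum f g = trans (sum-cong-≋ (λ i → sym (*-distribˡ-sum (f i) g))) (sym (*-distribʳ-sum (sum g) f))

  indicator : ∀ {p} {P : Set p} → Dec P → A → A
  indicator P? x = if does P? then x else 0#

  indicator-* : ∀ {p q r} {P : Set p} {Q : Set q} {Q′ : Set r} (P? : Dec P) (Q? : Dec Q) (Q′? : Dec Q′) →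
    P ⇔ (Q × Q′) → ∀ {x y y′} → x ≈ (y * y′) →
    indicator P? x ≈ (indicator Q? y * indicator Q′? y′)
  indicator-* (yes p) (yes q) (yes q′) P⇔QQ′ x≈yy′ = x≈yy′
  indicator-* (yes p) (yes q) (no ¬q′) P⇔QQ′ _ with _ , q′ ← Equivalence.to P⇔QQ′ p = contradiction q′ ¬q′
  indicator-* (yes p) (no ¬q) _        P⇔QQ′ _ with q , _ ← Equivalence.to P⇔QQ′ p = contradiction q ¬q
  indicator-* (no ¬p) (yes q) (yes q′) P⇔QQ′ _ = contradiction (Equivalence.from P⇔QQ′ (q , q′)) ¬p
  indicator-* (no ¬p) (yes q) (no ¬q′) P⇔QQ′ _ = sym (zeroʳ _)
  indicator-* (no ¬p) (no ¬q) _        P⇔QQ′ _ = sym (zeroˡ _)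

  module _ {x s} {X : Set x} {S : Pred X s} (S? : Decidable S) (g : X → A) where

    sumOver : List X → A
    sumOver xs = List.foldr _+_ 0# (List.map g (List.filter S? xs))

    sumOver-tabulate : ∀ {b} {B : Set b} {n} (pt : B → X) (h : Fin n → B) →
      sumOver (List.map pt (List.tabulate h)) ≈ sum (λ i → indicator (S? (pt (h i))) (g (pt (h i))))
    sumOver-tabulate {n = zero}  pt h = refl
    sumOver-tabulate {n = suc n} pt h with S? (pt (h zero))
    ... | yes _ = +-congˡ (sumOver-tabulate pt (h ∘ suc))
    ... | no  _ = trans (sumOver-tabulate pt (h ∘ suc)) (sym (+-identityˡ _))

  module _ {x x₁ x₂ s s₁ s₂} {X : Set x} {X₁ : Set x₁} {X₂ : Set x₂}
    {S : Pred X s} {S₁ : Pred X₁ s₁} {S₂ : Pred X₂ s₂}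
    (S? : Decidable S) (S₁? : Decidable S₁) (S₂? : Decidable S₂)
    {N N₁ N₂} (pt : Fin N → X) (pt₁ : Fin N₁ → X₁) (pt₂ : Fin N₂ → X₂)
    (σ : Permutation (N₁ ℕ.* N₂) N)
    (S⇔S₁×S₂ : ∀ i j → S (pt (σ ⟨$⟩ʳ combine i j)) ⇔ (S₁ (pt₁ i) × S₂ (pt₂ j)))
    (g : X → A) (g₁ : X₁ → A) (g₂ : X₂ → A)
    (g≈g₁*g₂ : ∀ i j → g (pt (σ ⟨$⟩ʳ combine i j)) ≈ (g₁ (pt₁ i) * g₂ (pt₂ j)))
    where

    -- The three sums are named so that a user can identify them up to _≈_ only.
    sum-product : ∀ t t₁ t₂ →
      t  ≈ List.foldr _+_ 0# (List.map g  (List.filter S?  (List.map pt  (List.allFin N)))) →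
      t₁ ≈ List.foldr _+_ 0# (List.map g₁ (List.filter S₁? (List.map pt₁ (List.allFin N₁)))) →
      t₂ ≈ List.foldr _+_ 0# (List.map g₂ (List.filter S₂? (List.map pt₂ (List.allFin N₂)))) →
      t ≈ (t₁ * t₂)
    sum-product t t₁ t₂ t≈ t₁≈ t₂≈ = begin
      t
        ≈⟨ t≈ ⟩
      sumOver S? g (List.map pt (List.allFin N))
        ≈⟨ sumOver-tabulate S? g pt id ⟩
      sum f
        ≈⟨ sum-permute f σ ⟩
      sum (λ k → f (σ ⟨$⟩ʳ k))
        ≈⟨ sum-combine N₁ (λ k → f (σ ⟨$⟩ʳ k)) ⟩
      sum {N₁} (λ i → sum {N₂} (λ j → f (σ ⟨$⟩ʳ combine i j)))
        ≈⟨ sum-cong-≋ {N₁} (λ i → sum-cong-≋ {N₂} (λ j →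
             indicator-* (S? (pt (σ ⟨$⟩ʳ combine i j))) (S₁? (pt₁ i)) (S₂? (pt₂ j)) (S⇔S₁×S₂ i j) (g≈g₁*g₂ i j))) ⟩
      sum (λ i → sum (λ j → f₁ i * f₂ j))
        ≈⟨ sum-*-sum f₁ f₂ ⟩
      sum f₁ * sum f₂
        ≈⟨ *-cong (sumOver-tabulate S₁? g₁ pt₁ id) (sumOver-tabulate S₂? g₂ pt₂ id) ⟨
      sumOver S₁? g₁ (List.map pt₁ (List.allFin N₁)) * sumOver S₂? g₂ (List.map pt₂ (List.allFin N₂))
        ≈⟨ *-cong t₁≈ t₂≈ ⟨
      t₁ * t₂ ∎
      where
      f : Fin N → A
      f k = indicator (S? (pt k)) (g (pt k))
      f₁ : Fin N₁ → A
      f₁ i = indicator (S₁? (pt₁ i)) (g₁ (pt₁ i))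
      f₂ : Fin N₂ → A
      f₂ j = indicator (S₂? (pt₂ j)) (g₂ (pt₂ j))

module Decompositions where

  open import Algebra.Bundles using (Ring)
  open import Algebra.Morphism.Structures using (module RingMorphisms)
  open import Algebra.Properties.Monoid.Mult using () renaming (_×_ to _⟨_⟩×_)
  open import Data.Fin.Base using (Fin; zero; suc; combine; remQuot; finToFun; funToFin; fromℕ; inject₁)
  open import Data.Fin.Permutation using (Permutation; permutation; _⟨$⟩ʳ_)
  open import Data.Fin.Properties using (combine-remQuot; remQuot-combine; funToFin-finToFin; finToFun-funToFin)
  open import Data.Integer.Base using (+_; -[1+_])
  open import Data.List.Base using ([]; _∷_)
  open import Data.Nat.Base as ℕ using (ℕ; zero; suc)
  open import Data.Product.Base using (_×_; _,_; proj₁; proj₂)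
  open import Function.Base using (_∘_)
  open import Function.Bundles using (Inverse; _⇔_; mk⇔)
  open import Level using (_⊔_)
  open import Relation.Binary.PropositionalEquality as ≡ using (_≡_; cong; cong₂)

  funToFin-cong : ∀ {m n} {f g : Fin m → Fin n} → (∀ i → f i ≡ g i) → funToFin f ≡ funToFin g
  funToFin-cong {zero}  f≗g = ≡.refl
  funToFin-cong {suc m} f≗g = cong₂ combine (f≗g zero) (funToFin-cong (f≗g ∘ suc))

  module Indexing {c ℓ} (R : FiniteRing c ℓ) (d : ℕ) where
    open FiniteRing R

    point : Fin (size ℕ.^ d) → Fin d → Carrier
    point k = Inverse.from enum ∘ finToFun k

    index : (Fin d → Carrier) → Fin (size ℕ.^ d)
    index x = funToFin (Inverse.to enum ∘ x)

    index-cong : ∀ {x y} → (∀ i → x i ≈ y i) → index x ≡ index y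
    index-cong x≈y = funToFin-cong λ i → Inverse.to-cong enum (x≈y i)

    index-point : ∀ k → index (point k) ≡ k
    index-point k = ≡.trans (funToFin-cong λ i → Inverse.strictlyInverseˡ enum (finToFun {size} {d} k i))
                            (funToFin-finToFin {d} k)

    point-index : ∀ x i → point (index x) i ≈ x i
    point-index x i = trans (Inverse.from-cong enum (finToFun-funToFin (Inverse.to enum ∘ x) i))
                            (Inverse.strictlyInverseʳ enum (x i))

  record Splitting {c ℓ c₁ ℓ₁ c₂ ℓ₂} (R : FiniteRing c ℓ) (R₁ : FiniteRing c₁ ℓ₁) (R₂ : FiniteRing c₂ ℓ₂) :
                   Set (c ⊔ ℓ ⊔ c₁ ⊔ ℓ₁ ⊔ c₂ ⊔ ℓ₂) where
    private
      module R  = FiniteRing R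
      module R₁ = FiniteRing R₁
      module R₂ = FiniteRing R₂
    field
      π₁        : R.Carrier → R₁.Carrier
      π₂        : R.Carrier → R₂.Carrier
      pair      : R₁.Carrier → R₂.Carrier → R.Carrier
      π₁-isHom  : RingMorphisms.IsRingHomomorphism R.rawRing R₁.rawRing π₁
      π₂-isHom  : RingMorphisms.IsRingHomomorphism R.rawRing R₂.rawRing π₂
      pair-cong : ∀ {x x′ y y′} → x R₁.≈ x′ → y R₂.≈ y′ → pair x y R.≈ pair x′ y′
      π₁-pair   : ∀ x y → π₁ (pair x y) R₁.≈ x
      π₂-pair   : ∀ x y → π₂ (pair x y) R₂.≈ y
      pair-π    : ∀ z → pair (π₁ z) (π₂ z) R.≈ z

    module π₁ = RingMorphisms.IsRingHomomorphism π₁-isHom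
    module π₂ = RingMorphisms.IsRingHomomorphism π₂-isHom

    pair-+ : ∀ x x′ y y′ → pair x y R.+ pair x′ y′ R.≈ pair (x R₁.+ x′) (y R₂.+ y′)
    pair-+ x x′ y y′ = R.trans (R.sym (pair-π _)) (pair-cong
      (R₁.trans (π₁.+-homo _ _) (R₁.+-cong (π₁-pair x y) (π₁-pair x′ y′)))
      (R₂.trans (π₂.+-homo _ _) (R₂.+-cong (π₂-pair x y) (π₂-pair x′ y′))))

  swap : ∀ {c ℓ c₁ ℓ₁ c₂ ℓ₂} {R : FiniteRing c ℓ} {R₁ : FiniteRing c₁ ℓ₁} {R₂ : FiniteRing c₂ ℓ₂} →
         Splitting R R₁ R₂ → Splitting R R₂ R₁
  swap sp = record
    { π₁ = π₂ ; π₂ = π₁ ; pair = λ y x → pair x y ; π₁-isHom = π₂-isHom ; π₂-isHom = π₁-isHom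
    ; pair-cong = λ y≈y′ x≈x′ → pair-cong x≈x′ y≈y′
    ; π₁-pair = λ y x → π₂-pair x y ; π₂-pair = λ y x → π₁-pair x y ; pair-π = pair-π
    }
    where open Splitting sp

  splitting : ∀ {c ℓ c₁ ℓ₁ c₂ ℓ₂} {R : FiniteRing c ℓ} {R₁ : FiniteRing c₁ ℓ₁} {R₂ : FiniteRing c₂ ℓ₂} →
              ProductDecomposition R R₁ R₂ → Splitting R R₁ R₂
  splitting {R = R} {R₁} {R₂} D = record
    { π₁ = proj₁ ∘ to
    ; π₂ = proj₂ ∘ to
    ; pair = λ x y → proj₁ (surjective (x , y))
    ; π₁-isHom = record
      { isSemiringHomomorphism = record
        { isNearSemiringHomomorphism = record
          { +-isMonoidHomomorphism = record
            { isMagmaHomomorphism = record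
              { isRelHomomorphism = record { cong = proj₁ ∘ ⟦⟧-cong }
              ; homo = λ x y → proj₁ (+-homo x y) }
            ; ε-homo = proj₁ 0#-homo }
          ; *-homo = λ x y → proj₁ (*-homo x y) }
        ; 1#-homo = proj₁ 1#-homo }
      ; -‿homo = λ x → proj₁ (-‿homo x) }
    ; π₂-isHom = record
      { isSemiringHomomorphism = record
        { isNearSemiringHomomorphism = record
          { +-isMonoidHomomorphism = record
            { isMagmaHomomorphism = record
              { isRelHomomorphism = record { cong = proj₂ ∘ ⟦⟧-cong }
              ; homo = λ x y → proj₂ (+-homo x y) }
            ; ε-homo = proj₂ 0#-homo }
          ; *-homo = λ x y → proj₂ (*-homo x y) }
        ; 1#-homo = proj₂ 1#-homo }
      ; -‿homo = λ x → proj₂ (-‿homo x) }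
    ; pair-cong = λ {x} {x′} {y} {y′} x≈x′ y≈y′ → injective
        ( R₁.trans (proj₁ (to-pair x y)) (R₁.trans x≈x′ (R₁.sym (proj₁ (to-pair x′ y′))))
        , R₂.trans (proj₂ (to-pair x y)) (R₂.trans y≈y′ (R₂.sym (proj₂ (to-pair x′ y′)))))
    ; π₁-pair = λ x y → proj₁ (to-pair x y)
    ; π₂-pair = λ x y → proj₂ (to-pair x y)
    ; pair-π = λ z → injective (to-pair (proj₁ (to z)) (proj₂ (to z)))
    }
    where
    open ProductDecomposition D
    open RingMorphisms.IsRingIsomorphism isIso
    module R = FiniteRing R
    module R₁ = FiniteRing R₁
    module R₂ = FiniteRing R₂
    to-pair : ∀ x y → (proj₁ (to (proj₁ (surjective (x , y)))) R₁.≈ x) × (proj₂ (to (proj₁ (surjective (x , y)))) R₂.≈ y)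
    to-pair x y = proj₂ (surjective (x , y)) R.refl

  module _ {c ℓ c₁ ℓ₁} (R : Ring c ℓ) (R₁ : Ring c₁ ℓ₁)
           {φ : Ring.Carrier R → Ring.Carrier R₁}
           (isHom : RingMorphisms.IsRingHomomorphism (Ring.rawRing R) (Ring.rawRing R₁) φ) where
    private
      module R  = Ring R
      module R₁ = Ring R₁
      module φ  = RingMorphisms.IsRingHomomorphism isHom

    ×-homo : ∀ n {x y} → y R₁.≈ φ x → (R₁.+-monoid ⟨ n ⟩× y) R₁.≈ φ (R.+-monoid ⟨ n ⟩× x)
    ×-homo zero    y≈φx = R₁.sym φ.0#-homo
    ×-homo (suc n) y≈φx = R₁.trans (R₁.+-cong y≈φx (×-homo n y≈φx)) (R₁.sym (φ.+-homo _ _))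

    ·ℤ-homo : ∀ a {x y} → y R₁.≈ φ x → _·ℤ_ R₁ a y R₁.≈ φ (_·ℤ_ R a x)
    ·ℤ-homo (+ n)    y≈φx = ×-homo n y≈φx
    ·ℤ-homo -[1+ n ] y≈φx = R₁.trans (R₁.-‿cong (×-homo (suc n) y≈φx)) (R₁.sym (φ.-‿homo _))

    module _ {n} {x : Fin n → R.Carrier} {y : Fin n → R₁.Carrier} (y≈φx : ∀ i → y i R₁.≈ φ (x i)) where

      evalWord-homo : ∀ w → evalWord R₁ w y R₁.≈ φ (evalWord R w x)
      evalWord-homo []      = R₁.sym φ.1#-homo
      evalWord-homo (i ∷ w) = R₁.trans (R₁.*-cong (y≈φx i) (evalWord-homo w)) (R₁.sym (φ.*-homo _ _))

      eval-homo : ∀ f → eval R₁ f y R₁.≈ φ (eval R f x)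
      eval-homo []            = R₁.sym φ.0#-homo
      eval-homo ((a , w) ∷ f) =
        R₁.trans (R₁.+-cong (·ℤ-homo a (evalWord-homo w)) (eval-homo f)) (R₁.sym (φ.+-homo _ _))

  module _ {c ℓ c₁ ℓ₁ c₂ ℓ₂} {R : FiniteRing c ℓ} {R₁ : FiniteRing c₁ ℓ₁} {R₂ : FiniteRing c₂ ℓ₂}
           (sp : Splitting R R₁ R₂) where
    private
      module R  = FiniteRing R
      module R₁ = FiniteRing R₁
      module R₂ = FiniteRing R₂
    open Splitting sp

    IsPair : ∀ {d} → (Fin d → R.Carrier) → (Fin d → R₁.Carrier) → (Fin d → R₂.Carrier) → Set ℓ
    IsPair x y z = ∀ i → x i R.≈ pair (y i) (z i)

    V-split : ∀ {n} (f : Polynomial n) c {x y z} → IsPair x y z → V f c R x ⇔ (V f c R₁ y × V f c R₂ z)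
    V-split {n} f c {x} {y} {z} x≈yz = mk⇔
      (λ Vx → R₁.trans (y≈π₁x (fromℕ n)) (R₁.trans (π₁.⟦⟧-cong Vx) (R₁.sym rhs₁))
            , R₂.trans (z≈π₂x (fromℕ n)) (R₂.trans (π₂.⟦⟧-cong Vx) (R₂.sym rhs₂)))
      (λ (Vy , Vz) → R.trans (R.sym (pair-π _)) (R.trans
        (pair-cong (R₁.trans (R₁.sym (y≈π₁x (fromℕ n))) (R₁.trans Vy rhs₁))
                   (R₂.trans (R₂.sym (z≈π₂x (fromℕ n))) (R₂.trans Vz rhs₂)))
        (pair-π _)))
      where
      y≈π₁x : ∀ i → y i R₁.≈ π₁ (x i)
      y≈π₁x i = R₁.sym (R₁.trans (π₁.⟦⟧-cong (x≈yz i)) (π₁-pair (y i) (z i)))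
      z≈π₂x : ∀ i → z i R₂.≈ π₂ (x i)
      z≈π₂x i = R₂.sym (R₂.trans (π₂.⟦⟧-cong (x≈yz i)) (π₂-pair (y i) (z i)))
      rhs₁ = R₁.trans (R₁.+-cong (eval-homo R.ring R₁.ring π₁-isHom (y≈π₁x ∘ inject₁) f)
                                 (·ℤ-homo R.ring R₁.ring π₁-isHom c (R₁.sym π₁.1#-homo)))
                      (R₁.sym (π₁.+-homo _ _))
      rhs₂ = R₂.trans (R₂.+-cong (eval-homo R.ring R₂.ring π₂-isHom (z≈π₂x ∘ inject₁) f)
                                 (·ℤ-homo R.ring R₂.ring π₂-isHom c (R₂.sym π₂.1#-homo)))
                      (R₂.sym (π₂.+-homo _ _))

    module _ (d : ℕ) where
      private
        module I  = Indexing R d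
        module I₁ = Indexing R₁ d
        module I₂ = Indexing R₂ d
        N₁ = R₁.size ℕ.^ d
        N₂ = R₂.size ℕ.^ d

      combinePoints : Fin N₁ × Fin N₂ → Fin d → R.Carrier
      combinePoints (k , l) i = pair (I₁.point k i) (I₂.point l i)

      indexPermutation : Permutation (N₁ ℕ.* N₂) (R.size ℕ.^ d)
      indexPermutation = permutation
        (I.index ∘ combinePoints ∘ remQuot N₂)
        (λ k → combine (I₁.index (π₁ ∘ I.point k)) (I₂.index (π₂ ∘ I.point k)))
        (λ k → ≡.trans (cong (I.index ∘ combinePoints) (remQuot-combine (I₁.index (π₁ ∘ I.point k)) _))
          (≡.trans (I.index-cong (λ i → R.trans
            (pair-cong (I₁.point-index (π₁ ∘ I.point k) i) (I₂.point-index (π₂ ∘ I.point k) i))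
            (pair-π (I.point k i)))) (I.index-point k)))
        (λ k → let q , r = remQuot {N₁} N₂ k in ≡.trans (cong₂ combine
          (≡.trans (I₁.index-cong λ i → R₁.trans (π₁.⟦⟧-cong (I.point-index (combinePoints (q , r)) i)) (π₁-pair _ _))
                   (I₁.index-point q))
          (≡.trans (I₂.index-cong λ i → R₂.trans (π₂.⟦⟧-cong (I.point-index (combinePoints (q , r)) i)) (π₂-pair _ _))
                   (I₂.index-point r)))
          (combine-remQuot {N₁} N₂ k))

      indexPermutation-isPair : ∀ k l →
        IsPair (I.point (indexPermutation ⟨$⟩ʳ combine k l)) (I₁.point k) (I₂.point l)
      indexPermutation-isPair k l i = R.trans (I.point-index (combinePoints (remQuot N₂ (combine k l))) i)
        (R.reflexive (cong (λ p → combinePoints p i) (remQuot-combine k l)))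

module Characters where

  open Reals
  open Complex
  open Decompositions
  open import Algebra.Bundles using (AbelianGroup)
  open import Data.Fin.Base using (Fin)

  open import Data.Integer.Base using (+_)
  open import Data.List.Base as List using (List)
  open import Data.Nat.Base as ℕ using (ℕ; zero; suc)
  import Data.Nat.Properties as ℕₚ
  open import Data.Product.Base using (∃-syntax; _×_; _,_)
  open import Data.Rational.Base as ℚ using (ℚ; 0ℚ; 1ℚ; _/_)
  import Data.Rational.Properties as ℚₚ

  open import Function.Bundles using (_⇔_; mk⇔; Equivalence)
  open import Relation.Binary.PropositionalEquality as ≡ using (_≡_; cong; subst)
  open import Relation.Nullary.Negation.Core using (¬_; contradiction)
  open import Relation.Unary using (Pred; Decidable)

  ≼-stable : ∀ {x y} → ¬ ¬ (x ≼ y) → x ≼ y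
  ≼-stable {x} {y} ¬¬x≼y = ≼-by-contradiction {x} {y} λ 0<η η≼x-y → ¬¬x≼y λ x≼y →
    positive⇒⋠0 0<η (≼-trans η≼x-y (≼-trans {y = y -ℝ y} (-ℝ-mono-≼ {x} {y} {y} {y} x≼y (≈⇒≼ ≈-refl))
      (pointwise-≤ λ n → ℚₚ.≤-reflexive (ℚₚ.+-inverseʳ (seq y n)))))

  x⋠x-1 : ∀ x → ¬ (x ≼ x -ℝ 1ℝ)
  x⋠x-1 x x≼x-1 = let N , h = un≼ x≼x-1 1ℚ (ℚₚ.positive⁻¹ 1ℚ) in
    ℚₚ.<-irrefl (≡.sym (≡.trans (ℚₚ.+-comm (seq x N ℚ.- 1ℚ) 1ℚ) (Rational.q+[p-q] (seq x N) 1ℚ))) (h N ℕₚ.≤-refl)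

  positive-inverse : ∀ {q} → 0ℚ ℚ.< q → ∃[ u ] (0ℝ ≼ u × fromℚ q *ℝ u ≈ 1ℝ)
  positive-inverse 0<q = let q⁻¹ , 0<q⁻¹ , qq⁻¹≡1 = shrink 0<q (ℚₚ.positive⁻¹ 1ℚ) in
    fromℚ q⁻¹ , pointwise-≤ (λ _ → ℚₚ.<⇒≤ 0<q⁻¹) , pointwise-≡ λ _ → qq⁻¹≡1

  scaled-bound : ∀ {q} → 0ℚ ℚ.< q → ∀ w z c y → w ≋ fromℚ q ·ℂ z →
    ∣ w ∣ℂ ≼ c *ℝ fromℚ q *ℝ y ⇔ ∣ z ∣ℂ ≼ c *ℝ y
  scaled-bound {q} 0<q w z c y w≋qz = mk⇔
    (λ b → let u , 0≼u , qu≈1 = positive-inverse 0<q in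
      *-unscale-≼ {u} {fromℚ q} {∣ z ∣ℂ} {c} {y} 0≼u qu≈1 (≼-trans (≈⇒≼ (≈-sym ∣w∣≈q∣z∣)) b))
    (λ b → ≼-trans (≈⇒≼ ∣w∣≈q∣z∣) (*-scale-≼ {fromℚ q} {∣ z ∣ℂ} {c} {y} 0≼q b))
    where
    0≼q : 0ℝ ≼ fromℚ q
    0≼q = pointwise-≤ λ _ → ℚₚ.<⇒≤ 0<q
    ∣w∣≈q∣z∣ : ∣ w ∣ℂ ≈ fromℚ q *ℝ ∣ z ∣ℂ
    ∣w∣≈q∣z∣ = ≈-trans {y = ∣ fromℚ q ·ℂ z ∣ℂ} (∣∣ℂ-cong {w} {fromℚ q ·ℂ z} w≋qz) (∣r·z∣≈r*∣z∣ 0≼q z)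

  module CharacterProperties {a ℓ} {G : AbelianGroup a ℓ} (ψ : Character G) where
    open AbelianGroup G hiding (_≈_)
    open Character ψ

    resp≋ : ∀ {x y} → AbelianGroup._≈_ G x y → ⟦ x ⟧ ≋ ⟦ y ⟧
    resp≋ {x} {y} x≈y = ≃ℂ⇒≋ ⟦ x ⟧ ⟦ y ⟧ (resp x≈y)

    homo≋ : ∀ x y → ⟦ x ∙ y ⟧ ≋ ⟦ x ⟧ *ℂ ⟦ y ⟧
    homo≋ x y = ≃ℂ⇒≋ ⟦ x ∙ y ⟧ (⟦ x ⟧ *ℂ ⟦ y ⟧) (homo x y)

  module _ {a ℓ b ℓ′} (G : AbelianGroup a ℓ) (H : AbelianGroup b ℓ′) where
    private
      module G = AbelianGroup G
      module H = AbelianGroup H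

    pullback : (φ : G.Carrier → H.Carrier) → (∀ {x y} → x G.≈ y → φ x H.≈ φ y) →
               (∀ x y → φ (x G.∙ y) H.≈ φ x H.∙ φ y) → Character H → Character G
    pullback φ φ-cong φ-homo χ = record
      { ⟦_⟧  = λ x → ⟦ φ x ⟧
      ; resp = λ x≈y → resp (φ-cong x≈y)
      ; homo = λ x y → ≋⇒≃ℂ ⟦ φ (x G.∙ y) ⟧ (⟦ φ x ⟧ *ℂ ⟦ φ y ⟧)
          (≋-trans {⟦ φ (x G.∙ y) ⟧} {⟦ φ x H.∙ φ y ⟧} {⟦ φ x ⟧ *ℂ ⟦ φ y ⟧} (resp≋ (φ-homo x y)) (homo≋ (φ x) (φ y)))
      ; unit = λ x → unit (φ x)
      }
      where
      open Character χ
      open CharacterProperties χ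

  total : ∀ {c ℓ p} (R : FiniteRing c ℓ) d (S : Pred (Fin d → FiniteRing.Carrier R) p) → Decidable S →
          ((Fin d → FiniteRing.Carrier R) → ℂ) → ℂ
  total R d S S? g = sumℂ (List.map g (List.filter S? (FiniteRing.points R d)))

  module Salem {c ℓ p} (R : FiniteRing c ℓ) (d : ℕ)
               {S : Pred (Fin d → FiniteRing.Carrier R) p} (S? : Decidable S)
               (m : ℕ) (card≡m : card R d {S = S} S? ≡ m) where
    open FiniteRing R using (size; size-nonZero; power; points)
    open Character

    0<1/∣R∣^d : 0ℚ ℚ.< 1/∣R∣^d R d
    0<1/∣R∣^d = ℚₚ.positive⁻¹ (1/∣R∣^d R d) {{ℚₚ.normalize-pos 1 (size ℕ.^ d) {{ℕₚ.m^n≢0 size d {{size-nonZero}}}}}}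

    -- Comparing the two sides as reals would also compare their Cauchy proofs, which is infeasible;
    -- comparing the underlying sequences is not.
    fourier≋ : ∀ ψ → fourier R d {S = S} S? ψ ≋ fromℚ (1/∣R∣^d R d) ·ℂ total R d S S? ⟦ ψ ⟧
    fourier≋ ψ = mk≋ (pointwise-≡ λ _ → ≡.refl) (pointwise-≡ λ _ → ≡.refl)

    fourier-bound : ∀ C ψ →
      ∣ fourier R d {S = S} S? ψ ∣ℂ ≼ C *ℝ fromℚ (1/∣R∣^d R d) *ℝ √ (fromℕʳ (card R d {S = S} S?)) ⇔
      ∣ total R d S S? ⟦ ψ ⟧ ∣ℂ ≼ C *ℝ √ (fromℕʳ (card R d {S = S} S?))
    fourier-bound C ψ = scaled-bound {1/∣R∣^d R d} 0<1/∣R∣^d (fourier R d {S = S} S? ψ)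
      (total R d S S? ⟦ ψ ⟧) C (√ (fromℕʳ (card R d {S = S} S?))) (fourier≋ ψ)

    bound : ∀ C → IsSalem R d {S = S} S? C → ∀ ψ → Nontrivial ψ → ∣ total R d S S? ⟦ ψ ⟧ ∣ℂ ≼ C *ℝ √ (fromℕʳ m)
    bound C salem ψ nt = subst (λ j → ∣ total R d S S? ⟦ ψ ⟧ ∣ℂ ≼ C *ℝ √ (fromℕʳ j)) {card R d {S = S} S?} {m} card≡m
      (Equivalence.to (fourier-bound C ψ)
        (mk≼ {∣ fourier R d {S = S} S? ψ ∣ℂ} {C *ℝ fromℚ (1/∣R∣^d R d) *ℝ √ (fromℕʳ (card R d {S = S} S?))} (salem ψ nt)))

    salem : ∀ C → (∀ ψ → Nontrivial ψ → ∣ total R d S S? ⟦ ψ ⟧ ∣ℂ ≼ C *ℝ √ (fromℕʳ m)) → IsSalem R d {S = S} S? C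
    salem C b ψ nt = un≼ (Equivalence.from (fourier-bound C ψ)
      (subst (λ j → ∣ total R d S S? ⟦ ψ ⟧ ∣ℂ ≼ C *ℝ √ (fromℕʳ j)) {m} {card R d {S = S} S?} (≡.sym card≡m) (b ψ nt)))

    ∣total∣≼m : (ψ : Character (power d)) → ∣ total R d S S? ⟦ ψ ⟧ ∣ℂ ≼ fromℕʳ m
    ∣total∣≼m ψ = subst (λ j → ∣ total R d S S? ⟦ ψ ⟧ ∣ℂ ≼ fromℕʳ j) {card R d {S = S} S?} {m} card≡m
      (∣∑unit∣≼length ⟦ ψ ⟧ (λ x → mk≈ (unit ψ x)) (List.filter S? (points d)))

    total-1 : ∀ g → (∀ x → g x ≋ 1ℂ) → total R d S S? g ≋ fromℕʳ m +i 0ℝ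
    total-1 g g≋1 = subst (λ j → total R d S S? g ≋ fromℕʳ j +i 0ℝ) {card R d {S = S} S?} {m} card≡m
      (∑1≋length g (λ x → re≈ (g≋1 x) , im≈ (g≋1 x)) (List.filter S? (points d)))

    0<m : ∀ C → (∀ C′ → IsSalem R d {S = S} S? C′ → C ≤ℝ C′) → 0ℚ ℚ.< + m / 1
    0<m C least = m>0 m ≡.refl
      where
      m>0 : ∀ j → m ≡ j → 0ℚ ℚ.< + m / 1
      m>0 (suc j) eq = subst (λ j → 0ℚ ℚ.< + j / 1) (≡.sym eq) (ℚₚ.positive⁻¹ (+ suc j / 1) {{ℚₚ.normalize-pos (suc j) 1}})
      -- With no points every real is a Salem constant, so none is least.
      m>0 zero eq = contradiction (mk≼ (least (C -ℝ 1ℝ) (salem (C -ℝ 1ℝ) λ ψ _ →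
        √-zero-bound {fromℕʳ m} {∣ total R d S S? ⟦ ψ ⟧ ∣ℂ} (pointwise-≡ λ _ → cong (λ m → + m / 1) eq) (∣total∣≼m ψ) (C -ℝ 1ℝ))))
        (x⋠x-1 C)

module ProductSets where

  open Reals
  open Complex
  open Decompositions
  open Characters
  open import Data.Fin.Base using (Fin; combine)
  open import Data.Fin.Permutation using (_⟨$⟩ʳ_)
  open import Data.Integer.Base using (+_)
  import Data.List.Base as List
  open import Data.Nat.Base as ℕ using (ℕ)
  open import Data.Product.Base using (∃-syntax; _×_; _,_)
  open import Data.Rational.Base as ℚ using (ℚ; 0ℚ; 1ℚ; _/_)
  open import Data.Rational.Properties using (positive⁻¹; <⇒≤)

  open import Function.Bundles using (_⇔_; mk⇔; Equivalence)
  open import Relation.Binary.PropositionalEquality as ≡ using (_≡_)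

  open import Relation.Unary using (Pred; Decidable)

  open FiniteSums _≋_ _+ℂ_ _*ℂ_ 0ℂ 1ℂ ℂ-isCommutativeSemiring using (sum-product)

  real-* : ∀ x y → (x +i 0ℝ) *ℂ (y +i 0ℝ) ≋ (x *ℝ y) +i 0ℝ
  real-* x y = mk≋ (pointwise-≡ λ n → Rational.p-0*0 (seq x n ℚ.* seq y n))
                   (pointwise-≡ λ n → Rational.p*0+0*q (seq x n) (seq y n))

  ∣real∣ : ∀ {x} → 0ℝ ≼ x → ∣ x +i 0ℝ ∣ℂ ≈ x
  ∣real∣ {x} 0≼x = ≈-trans {y = √ (x *ℝ x +ℝ 0ℝ *ℝ 0ℝ)}
    (∣∣ℂ-def (x +i 0ℝ) {x} {0ℝ} ≈-refl ≈-refl) (modulus-real {x} 0≼x)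

  ≋-*-1 : ∀ u v w → u ≋ v → w ≋ 1ℂ → u ≋ v *ℂ w
  ≋-*-1 u v w u≋v w≋1 = ≋-trans {u} {v *ℂ 1ℂ} {v *ℂ w}
    (≋-trans {u} {v} {v *ℂ 1ℂ} u≋v (≋-sym {v *ℂ 1ℂ} {v} (*ℂ-identityʳ v)))
    (*ℂ-cong {v} {v} {1ℂ} {w} ≋-refl (≋-sym {w} {1ℂ} w≋1))

  const-1 : ∀ {c ℓ} (R : FiniteRing c ℓ) d → (Fin d → FiniteRing.Carrier R) → ℂ
  const-1 R d _ = 1ℂ

  -- The half of the argument that concerns R₁; the other half is its instance at the swapped splitting.
  module FirstFactor {c ℓ c₁ ℓ₁ c₂ ℓ₂ p p₁ p₂}
    {R : FiniteRing c ℓ} {R₁ : FiniteRing c₁ ℓ₁} {R₂ : FiniteRing c₂ ℓ₂} (sp : Splitting R R₁ R₂) (d : ℕ)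
    {S  : Pred (Fin d → FiniteRing.Carrier R) p} (S? : Decidable S)
    {S₁ : Pred (Fin d → FiniteRing.Carrier R₁) p₁} (S₁? : Decidable S₁)
    {S₂ : Pred (Fin d → FiniteRing.Carrier R₂) p₂} (S₂? : Decidable S₂)
    (S-split : ∀ {x y z} → IsPair sp x y z → S x ⇔ (S₁ y × S₂ z))
    (m m₁ m₂ : ℕ) (card≡m : card R d {S = S} S? ≡ m)
    (card≡m₁ : card R₁ d {S = S₁} S₁? ≡ m₁) (card≡m₂ : card R₂ d {S = S₂} S₂? ≡ m₂)
    where

    private
      module R  = FiniteRing R
      module R₁ = FiniteRing R₁
      module R₂ = FiniteRing R₂
      module T  = Salem R  d {S = S}  S?  m  card≡m
      module T₁ = Salem R₁ d {S = S₁} S₁? m₁ card≡m₁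
      module T₂ = Salem R₂ d {S = S₂} S₂? m₂ card≡m₂
    open Splitting sp
    open Character

    total-* : ∀ g g₁ g₂ → (∀ x y z → IsPair sp x y z → g x ≋ g₁ y *ℂ g₂ z) →
              total R d S S? g ≋ total R₁ d S₁ S₁? g₁ *ℂ total R₂ d S₂ S₂? g₂
    total-* g g₁ g₂ g≋g₁*g₂ =
      let point  = Indexing.point R d
          point₁ = Indexing.point R₁ d
          point₂ = Indexing.point R₂ d
          σ      = indexPermutation sp d
          total≋ = sum-product S? S₁? S₂? point point₁ point₂ σ
            (λ i j → S-split {point (σ ⟨$⟩ʳ combine i j)} {point₁ i} {point₂ j} (indexPermutation-isPair sp d i j)) g g₁ g₂
            (λ i j → g≋g₁*g₂ (point (σ ⟨$⟩ʳ combine i j)) (point₁ i) (point₂ j) (indexPermutation-isPair sp d i j))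
            (total R d S S? g) (total R₁ d S₁ S₁? g₁) (total R₂ d S₂ S₂? g₂)
            (mk≋ (pointwise-≡ λ _ → ≡.refl) (pointwise-≡ λ _ → ≡.refl))
            (mk≋ (pointwise-≡ λ _ → ≡.refl) (pointwise-≡ λ _ → ≡.refl))
            (mk≋ (pointwise-≡ λ _ → ≡.refl) (pointwise-≡ λ _ → ≡.refl))
      in total≋

    m≈m₁*m₂ : fromℕʳ m ≈ fromℕʳ m₁ *ℝ fromℕʳ m₂
    m≈m₁*m₂ = re≈ {fromℕʳ m +i 0ℝ} {(fromℕʳ m₁ *ℝ fromℕʳ m₂) +i 0ℝ}
      (≋-trans {fromℕʳ m +i 0ℝ} {total R d S S? (const-1 R d)} {(fromℕʳ m₁ *ℝ fromℕʳ m₂) +i 0ℝ}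
        (≋-sym {total R d S S? (const-1 R d)} {fromℕʳ m +i 0ℝ} (T.total-1 (const-1 R d) (λ _ → ≋-refl)))
        (≋-trans {total R d S S? (const-1 R d)} {total R₁ d S₁ S₁? (const-1 R₁ d) *ℂ total R₂ d S₂ S₂? (const-1 R₂ d)} {(fromℕʳ m₁ *ℝ fromℕʳ m₂) +i 0ℝ}
          (total-* (const-1 R d) (const-1 R₁ d) (const-1 R₂ d)
            (λ x y z _ → ≋-*-1 (const-1 R d x) (const-1 R₁ d y) (const-1 R₂ d z) ≋-refl ≋-refl))
          (≋-trans {total R₁ d S₁ S₁? (const-1 R₁ d) *ℂ total R₂ d S₂ S₂? (const-1 R₂ d)} {(fromℕʳ m₁ +i 0ℝ) *ℂ (fromℕʳ m₂ +i 0ℝ)} {(fromℕʳ m₁ *ℝ fromℕʳ m₂) +i 0ℝ}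
            (*ℂ-cong {total R₁ d S₁ S₁? (const-1 R₁ d)} {fromℕʳ m₁ +i 0ℝ} {total R₂ d S₂ S₂? (const-1 R₂ d)} {fromℕʳ m₂ +i 0ℝ}
              (T₁.total-1 (const-1 R₁ d) (λ _ → ≋-refl)) (T₂.total-1 (const-1 R₂ d) (λ _ → ≋-refl)))
            (real-* (fromℕʳ m₁) (fromℕʳ m₂)))))

    ∣total∣-* : ∀ g g₁ g₂ → (∀ x y z → IsPair sp x y z → g x ≋ g₁ y *ℂ g₂ z) →
                ∣ total R d S S? g ∣ℂ ≈ ∣ total R₁ d S₁ S₁? g₁ ∣ℂ *ℝ ∣ total R₂ d S₂ S₂? g₂ ∣ℂ
    ∣total∣-* g g₁ g₂ g≋g₁*g₂ = ≈-trans {y = ∣ total R₁ d S₁ S₁? g₁ *ℂ total R₂ d S₂ S₂? g₂ ∣ℂ}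
      (∣∣ℂ-cong {total R d S S? g} {total R₁ d S₁ S₁? g₁ *ℂ total R₂ d S₂ S₂? g₂} (total-* g g₁ g₂ g≋g₁*g₂))
      (∣z*w∣≈∣z∣*∣w∣ (total R₁ d S₁ S₁? g₁) (total R₂ d S₂ S₂? g₂))

    restrict₁ : Character (R.power d) → Character (R₁.power d)
    restrict₁ = pullback (R₁.power d) (R.power d) (λ y i → pair (y i) R₂.0#)
      (λ y≈y′ i → pair-cong (y≈y′ i) R₂.refl)
      (λ y y′ i → R.sym (R.trans (pair-+ (y i) (y′ i) R₂.0# R₂.0#) (pair-cong R₁.refl (R₂.+-identityˡ R₂.0#))))

    restrict₂ : Character (R.power d) → Character (R₂.power d)
    restrict₂ = pullback (R₂.power d) (R.power d) (λ z i → pair R₁.0# (z i))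
      (λ z≈z′ i → pair-cong R₁.refl (z≈z′ i))
      (λ z z′ i → R.sym (R.trans (pair-+ R₁.0# R₁.0# (z i) (z′ i)) (pair-cong (R₁.+-identityˡ R₁.0#) R₂.refl)))

    extend₁ : Character (R₁.power d) → Character (R.power d)
    extend₁ = pullback (R.power d) (R₁.power d) (λ x i → π₁ (x i))
      (λ x≈x′ i → π₁.⟦⟧-cong (x≈x′ i)) (λ x x′ i → π₁.+-homo (x i) (x′ i))

    ψ≋restrict₁*restrict₂ : ∀ ψ x y z → IsPair sp x y z → ⟦ ψ ⟧ x ≋ ⟦ restrict₁ ψ ⟧ y *ℂ ⟦ restrict₂ ψ ⟧ z
    ψ≋restrict₁*restrict₂ ψ x y z x≈yz = ≋-trans {⟦ ψ ⟧ x} {⟦ ψ ⟧ (λ i → y0 i R.+ 0z i)} {⟦ restrict₁ ψ ⟧ y *ℂ ⟦ restrict₂ ψ ⟧ z}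
      (resp≋ λ i → R.trans (x≈yz i) (R.sym (R.trans (pair-+ (y i) R₁.0# R₂.0# (z i))
        (pair-cong (R₁.+-identityʳ (y i)) (R₂.+-identityˡ (z i))))))
      (≋-trans {⟦ ψ ⟧ (λ i → y0 i R.+ 0z i)} {⟦ ψ ⟧ y0 *ℂ ⟦ ψ ⟧ 0z} {⟦ restrict₁ ψ ⟧ y *ℂ ⟦ restrict₂ ψ ⟧ z}
        (homo≋ y0 0z)
        (*ℂ-cong {⟦ ψ ⟧ y0} {⟦ restrict₁ ψ ⟧ y} {⟦ ψ ⟧ 0z} {⟦ restrict₂ ψ ⟧ z} ≋-refl ≋-refl))
      where
      open CharacterProperties ψ
      y0 0z : Fin d → R.Carrier
      y0 i = pair (y i) R₂.0#
      0z i = pair R₁.0# (z i)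

    bound-by-restrict₁ : ∀ C₁ M → IsSalem R₁ d {S = S₁} S₁? C₁ → C₁ *ℝ √ (fromℕʳ m₂) ≼ M →
      ∀ ψ → Nontrivial (restrict₁ ψ) → ∣ total R d S S? ⟦ ψ ⟧ ∣ℂ ≼ M *ℝ √ (fromℕʳ m)
    bound-by-restrict₁ C₁ M salem₁ C₁√m₂≼M ψ nt = product-bound
      {∣ total R₁ d S₁ S₁? ⟦ restrict₁ ψ ⟧ ∣ℂ} {fromℕʳ m₁} {fromℕʳ m₂} {∣ total R d S S? ⟦ ψ ⟧ ∣ℂ}
      {∣ total R₂ d S₂ S₂? ⟦ restrict₂ ψ ⟧ ∣ℂ} {fromℕʳ m} {C₁} {M}
      (0≼∣z∣ (total R₁ d S₁ S₁? ⟦ restrict₁ ψ ⟧)) (0≼fromℕʳ m₁) (0≼fromℕʳ m₂)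
      (∣total∣-* ⟦ ψ ⟧ ⟦ restrict₁ ψ ⟧ ⟦ restrict₂ ψ ⟧ (ψ≋restrict₁*restrict₂ ψ)) m≈m₁*m₂
      (T₁.bound C₁ salem₁ (restrict₁ ψ) nt) (T₂.∣total∣≼m (restrict₂ ψ)) C₁√m₂≼M

    π₁-pair≈ : ∀ {x : Fin d → R.Carrier} {y z} → IsPair sp x y z → ∀ i → π₁ (x i) R₁.≈ y i
    π₁-pair≈ {y = y} {z} x≈yz i = R₁.trans (π₁.⟦⟧-cong (x≈yz i)) (π₁-pair (y i) (z i))

    extend₁-nontrivial : ∀ ψ₁ → Nontrivial ψ₁ → Nontrivial (extend₁ ψ₁)
    extend₁-nontrivial ψ₁ nt triv = nt λ y → ≋⇒≃ℂ (⟦ ψ₁ ⟧ y) 1ℂ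
      (≋-trans {⟦ ψ₁ ⟧ y} {⟦ ψ₁ ⟧ (λ i → π₁ (pair (y i) R₂.0#))} {1ℂ}
        (CharacterProperties.resp≋ ψ₁ (λ i → R₁.sym (π₁-pair (y i) R₂.0#)))
        (≃ℂ⇒≋ (⟦ ψ₁ ⟧ (λ i → π₁ (pair (y i) R₂.0#))) 1ℂ (triv (λ i → pair (y i) R₂.0#))))

    extend₁≋ : ∀ ψ₁ x y z → IsPair sp x y z → ⟦ extend₁ ψ₁ ⟧ x ≋ ⟦ ψ₁ ⟧ y *ℂ const-1 R₂ d z
    extend₁≋ ψ₁ x y z x≈yz = ≋-*-1 (⟦ extend₁ ψ₁ ⟧ x) (⟦ ψ₁ ⟧ y) (const-1 R₂ d z)
      (CharacterProperties.resp≋ ψ₁ (π₁-pair≈ x≈yz)) ≋-refl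

    ∣total-extend₁∣ : ∀ ψ₁ → ∣ total R d S S? ⟦ extend₁ ψ₁ ⟧ ∣ℂ ≈ ∣ total R₁ d S₁ S₁? ⟦ ψ₁ ⟧ ∣ℂ *ℝ fromℕʳ m₂
    ∣total-extend₁∣ ψ₁ = ≈-trans {y = ∣ total R₁ d S₁ S₁? ⟦ ψ₁ ⟧ ∣ℂ *ℝ ∣ total R₂ d S₂ S₂? (const-1 R₂ d) ∣ℂ}
      (∣total∣-* ⟦ extend₁ ψ₁ ⟧ ⟦ ψ₁ ⟧ (const-1 R₂ d) (extend₁≋ ψ₁))
      (*-cong {∣ total R₁ d S₁ S₁? ⟦ ψ₁ ⟧ ∣ℂ} {∣ total R₁ d S₁ S₁? ⟦ ψ₁ ⟧ ∣ℂ} {∣ total R₂ d S₂ S₂? (const-1 R₂ d) ∣ℂ} {fromℕʳ m₂} ≈-refl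
        (≈-trans {y = ∣ fromℕʳ m₂ +i 0ℝ ∣ℂ}
          (∣∣ℂ-cong {total R₂ d S₂ S₂? (const-1 R₂ d)} {fromℕʳ m₂ +i 0ℝ} (T₂.total-1 (const-1 R₂ d) (λ _ → ≋-refl)))
          (∣real∣ (0≼fromℕʳ m₂))))

    least-bound : ∀ C₁ C u → 0ℝ ≼ u → fromℕʳ m₂ *ℝ u ≈ 1ℝ → (∀ C₁′ → IsSalem R₁ d {S = S₁} S₁? C₁′ → C₁ ≤ℝ C₁′) →
      IsSalem R d {S = S} S? C → C₁ *ℝ √ (fromℕʳ m₂) ≼ C
    least-bound C₁ C u 0≼u m₂u≈1 least₁ salem = clear-root {fromℕʳ m₂} {u} {C₁} {C} (0≼fromℕʳ m₂) m₂u≈1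
      (mk≼ {C₁} {C *ℝ (√ (fromℕʳ m₂) *ℝ u)} (least₁ (C *ℝ (√ (fromℕʳ m₂) *ℝ u)) (T₁.salem (C *ℝ (√ (fromℕʳ m₂) *ℝ u)) bound₁)))
      where
      bound₁ : ∀ ψ₁ → Nontrivial ψ₁ →
        ∣ total R₁ d S₁ S₁? ⟦ ψ₁ ⟧ ∣ℂ ≼ (C *ℝ (√ (fromℕʳ m₂) *ℝ u)) *ℝ √ (fromℕʳ m₁)
      bound₁ ψ₁ nt = factor-bound {fromℕʳ m₁} {fromℕʳ m₂} {u} {∣ total R d S S? ⟦ extend₁ ψ₁ ⟧ ∣ℂ}
        {∣ total R₁ d S₁ S₁? ⟦ ψ₁ ⟧ ∣ℂ} {fromℕʳ m} {C} (0≼fromℕʳ m₁) (0≼fromℕʳ m₂) 0≼u m₂u≈1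
        (∣total-extend₁∣ ψ₁) m≈m₁*m₂ (T.bound C salem (extend₁ ψ₁) (extend₁-nontrivial ψ₁ nt))

  fromℕʳ-inverse : ∀ m → 0ℚ ℚ.< + m / 1 → ∃[ u ] (0ℝ ≼ u × fromℕʳ m *ℝ u ≈ 1ℝ)
  fromℕʳ-inverse m 0<m = let q , 0<q , mq≡1 = shrink 0<m (positive⁻¹ 1ℚ) in
    fromℚ q , pointwise-≤ (λ _ → <⇒≤ 0<q) , pointwise-≡ λ _ → mq≡1

  module Product {c ℓ c₁ ℓ₁ c₂ ℓ₂ p p₁ p₂}
    {R : FiniteRing c ℓ} {R₁ : FiniteRing c₁ ℓ₁} {R₂ : FiniteRing c₂ ℓ₂} (sp : Splitting R R₁ R₂) (d : ℕ)
    {S  : Pred (Fin d → FiniteRing.Carrier R) p} (S? : Decidable S)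
    {S₁ : Pred (Fin d → FiniteRing.Carrier R₁) p₁} (S₁? : Decidable S₁)
    {S₂ : Pred (Fin d → FiniteRing.Carrier R₂) p₂} (S₂? : Decidable S₂)
    (S-split : ∀ {x y z} → IsPair sp x y z → S x ⇔ (S₁ y × S₂ z))
    (m m₁ m₂ : ℕ) (card≡m : card R d {S = S} S? ≡ m)
    (card≡m₁ : card R₁ d {S = S₁} S₁? ≡ m₁) (card≡m₂ : card R₂ d {S = S₂} S₂? ≡ m₂)
    (C₁ C₂ : ℝ) (salem₁ : IsSalem R₁ d {S = S₁} S₁? C₁) (salem₂ : IsSalem R₂ d {S = S₂} S₂? C₂)
    (least₁ : ∀ C′ → IsSalem R₁ d {S = S₁} S₁? C′ → C₁ ≤ℝ C′)
    (least₂ : ∀ C′ → IsSalem R₂ d {S = S₂} S₂? C′ → C₂ ≤ℝ C′)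
    where

    private
      module R  = FiniteRing R
      module R₁ = FiniteRing R₁
      module R₂ = FiniteRing R₂
      module T  = Salem R  d {S = S}  S?  m  card≡m
      module T₁ = Salem R₁ d {S = S₁} S₁? m₁ card≡m₁
      module T₂ = Salem R₂ d {S = S₂} S₂? m₂ card≡m₂
      module H₁ = FirstFactor sp d {S = S} S? {S₁ = S₁} S₁? {S₂ = S₂} S₂? S-split m m₁ m₂ card≡m card≡m₁ card≡m₂

      S-split′ : ∀ {x y z} → IsPair (swap sp) x y z → S x ⇔ (S₂ y × S₁ z)
      S-split′ x≈zy = mk⇔ (λ Sx → let Sy , Sz = Equivalence.to (S-split x≈zy) Sx in Sz , Sy)
                          (λ (Sz , Sy) → Equivalence.from (S-split x≈zy) (Sy , Sz))

      module H₂ = FirstFactor (swap sp) d {S = S} S? {S₁ = S₂} S₂? {S₂ = S₁} S₁? S-split′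
        m m₂ m₁ card≡m card≡m₂ card≡m₁
    open Splitting sp
    open Character

    trivial-restrictions : ∀ ψ → (∀ y → ⟦ H₁.restrict₁ ψ ⟧ y ≃ℂ 1ℂ) → (∀ z → ⟦ H₂.restrict₁ ψ ⟧ z ≃ℂ 1ℂ) →
                           ∀ x → ⟦ ψ ⟧ x ≃ℂ 1ℂ
    trivial-restrictions ψ triv₁ triv₂ x = ≋⇒≃ℂ (⟦ ψ ⟧ x) 1ℂ
      (≋-trans {⟦ ψ ⟧ x} {⟦ H₁.restrict₁ ψ ⟧ y} {1ℂ}
        (≋-trans {⟦ ψ ⟧ x} {⟦ H₁.restrict₁ ψ ⟧ y *ℂ ⟦ H₁.restrict₂ ψ ⟧ z} {⟦ H₁.restrict₁ ψ ⟧ y}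
          (H₁.ψ≋restrict₁*restrict₂ ψ x y z (λ i → R.sym (pair-π (x i))))
          (≋-sym {⟦ H₁.restrict₁ ψ ⟧ y} {⟦ H₁.restrict₁ ψ ⟧ y *ℂ ⟦ H₁.restrict₂ ψ ⟧ z}
            (≋-*-1 (⟦ H₁.restrict₁ ψ ⟧ y) (⟦ H₁.restrict₁ ψ ⟧ y) (⟦ H₁.restrict₂ ψ ⟧ z) ≋-refl
              (≃ℂ⇒≋ (⟦ H₁.restrict₂ ψ ⟧ z) 1ℂ (triv₂ z)))))
        (≃ℂ⇒≋ (⟦ H₁.restrict₁ ψ ⟧ y) 1ℂ (triv₁ y)))
      where
      y : Fin d → R₁.Carrier
      y i = π₁ (x i)
      z : Fin d → R₂.Carrier
      z i = π₂ (x i)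

    upper : ∀ M → C₁ *ℝ √ (fromℕʳ m₂) ≼ M → C₂ *ℝ √ (fromℕʳ m₁) ≼ M → IsSalem R d {S = S} S? M
    upper M ≼M₁ ≼M₂ = T.salem M λ ψ nt → ≼-stable {∣ total R d S S? ⟦ ψ ⟧ ∣ℂ} {M *ℝ √ (fromℕʳ m)} λ ¬bound →
      (λ nt₁ → ¬bound (H₁.bound-by-restrict₁ C₁ M salem₁ ≼M₁ ψ nt₁)) λ triv₁ →
      (λ nt₂ → ¬bound (H₂.bound-by-restrict₁ C₂ M salem₂ ≼M₂ ψ nt₂)) λ triv₂ →
      nt (trivial-restrictions ψ triv₁ triv₂)

    lower₁ : ∀ C → IsSalem R d {S = S} S? C → C₁ *ℝ √ (fromℕʳ m₂) ≼ C
    lower₁ C salem = let u , 0≼u , m₂u≈1 = fromℕʳ-inverse m₂ (T₂.0<m C₂ least₂) in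
      H₁.least-bound C₁ C u 0≼u m₂u≈1 least₁ salem

    lower₂ : ∀ C → IsSalem R d {S = S} S? C → C₂ *ℝ √ (fromℕʳ m₁) ≼ C
    lower₂ C salem = let u , 0≼u , m₁u≈1 = fromℕʳ-inverse m₁ (T₁.0<m C₁ least₁) in
      H₂.least-bound C₂ C u 0≼u m₁u≈1 least₂ salem

    salemNumber⇔ : ∀ C M → C₁ *ℝ √ (fromℕʳ m₂) ≼ M → C₂ *ℝ √ (fromℕʳ m₁) ≼ M →
      (∀ D → C₁ *ℝ √ (fromℕʳ m₂) ≼ D → C₂ *ℝ √ (fromℕʳ m₁) ≼ D → M ≼ D) →
      (IsSalem R d {S = S} S? C × (∀ C′ → IsSalem R d {S = S} S? C′ → C ≤ℝ C′)) ⇔ C ≈ M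
    salemNumber⇔ C M ≼M₁ ≼M₂ lub = mk⇔
      (λ (salem , least) → ≼-antisym (mk≼ {C} {M} (least M (upper M ≼M₁ ≼M₂))) (M≼ C salem))
      (λ C≈M →
        let M≼C = ≈⇒≼ (≈-sym C≈M) in
          upper C (≼-trans {C₁ *ℝ √ (fromℕʳ m₂)} {M} {C} ≼M₁ M≼C) (≼-trans {C₂ *ℝ √ (fromℕʳ m₁)} {M} {C} ≼M₂ M≼C)
        , λ C′ salem → un≼ {C} {C′} (≼-trans {C} {M} {C′} (≈⇒≼ C≈M) (M≼ C′ salem)))
      where
      M≼ : ∀ D → IsSalem R d {S = S} S? D → M ≼ D
      M≼ D salem = lub D (lower₁ D salem) (lower₂ D salem)

open Reals
open Complex
open Decompositions
open Characters
open ProductSets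
open import Data.Integer.Base using (ℤ; 0ℤ)
open import Data.Nat.Base using (ℕ; suc; _≤_)
open import Data.Product.Base using (_×_; _,_)
open import Function.Bundles using (_⇔_; mk⇔; Equivalence)
open import Level using (Level)
open import Relation.Binary.PropositionalEquality using (_≡_; refl)

lemma2p22 : ∀ (n : ℕ) → 2 ≤ suc n →
    (f : Polynomial n) → constantTerm f ≡ 0ℤ →
    (c : ℤ) →
    {a ℓ a₁ ℓ₁ a₂ ℓ₂ : Level}
    (R : FiniteRing a ℓ) (R₁ : FiniteRing a₁ ℓ₁) (R₂ : FiniteRing a₂ ℓ₂) →
    ProductDecomposition R R₁ R₂ →
    (C C₁ C₂ : ℝ) →
    IsSalemNumber f c R₁ C₁ → IsSalemNumber f c R₂ C₂ →
    IsSalemNumber f c R C ⇔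
    C ≃ℝ (C₁ *ℝ √ (fromℕʳ (∣V∣ f c R₂))) ⊔ℝ (C₂ *ℝ √ (fromℕʳ (∣V∣ f c R₁)))
lemma2p22 n _ f _ c R R₁ R₂ D C C₁ C₂ (salem₁ , least₁) (salem₂ , least₂) =
  mk⇔ (λ salemNumber → un≈ {C} {(C₁ *ℝ √ (fromℕʳ (∣V∣ f c R₂))) ⊔ℝ (C₂ *ℝ √ (fromℕʳ (∣V∣ f c R₁)))} (Equivalence.to numbers salemNumber))
      (λ C≃M → Equivalence.from numbers (mk≈ {C} {(C₁ *ℝ √ (fromℕʳ (∣V∣ f c R₂))) ⊔ℝ (C₂ *ℝ √ (fromℕʳ (∣V∣ f c R₁)))} C≃M))
  where
  split : ∀ {x y z} → IsPair (splitting D) x y z → V f c R x ⇔ (V f c R₁ y × V f c R₂ z)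
  split {x} {y} {z} = V-split (splitting D) f c {x} {y} {z}
  module P = Product (splitting D) (suc n) {S = V f c R} (V? f c R) {S₁ = V f c R₁} (V? f c R₁) {S₂ = V f c R₂} (V? f c R₂) split
    (∣V∣ f c R) (∣V∣ f c R₁) (∣V∣ f c R₂) refl refl refl C₁ C₂ salem₁ salem₂ least₁ least₂
  numbers = P.salemNumber⇔ C ((C₁ *ℝ √ (fromℕʳ (∣V∣ f c R₂))) ⊔ℝ (C₂ *ℝ √ (fromℕʳ (∣V∣ f c R₁))))
    (x≼x⊔y (C₁ *ℝ √ (fromℕʳ (∣V∣ f c R₂))) (C₂ *ℝ √ (fromℕʳ (∣V∣ f c R₁))))
    (y≼x⊔y (C₁ *ℝ √ (fromℕʳ (∣V∣ f c R₂))) (C₂ *ℝ √ (fromℕʳ (∣V∣ f c R₁))))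
    (λ C′ → ⊔ℝ-lub {C₁ *ℝ √ (fromℕʳ (∣V∣ f c R₂))} {C′} {C₂ *ℝ √ (fromℕʳ (∣V∣ f c R₁))})
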